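{- Let $\delta\in\{\mathsf n,\mathsf u,\mathsf d,\mathsf{ud}\}^n$ be a decoration, and let $\equiv_\delta$ be the corresponding permutree congruence on $S_n$. The permutree stack-sorting operator $\mathbf S_{\equiv_\delta}:S_n\to S_n$ satisfies the identity $$\mathbf S_{\equiv_\delta}=\mathcal P\circ\mathcal I_\delta^{ -1}.$$
   Context: Decorations are words over a four-letter alphabet: $\mathsf n$ (no wall), $\mathsf u$ (upward wall), $\mathsf d$ (downward wall), $\mathsf{ud}$ (both). In a directed tree, $u$ is a parent (child) of $v$ if there is an arrow $v\to u$ ($u\to v$), and an ancestor (descendant) of $v$ if there is a directed path with at least one arrow from $v$ to $u$ (from $u$ to $v$). Permutrees. For $\delta=\delta_1\cdots\delta_n$, a $\delta$-permutree is a directed plane tree $T$ with a bijection $p:V(T)\to[n]$ such that, for each vertex $v$: if $\delta_{p(v)}\in\{\mathsf n,\mathsf d\}$, $v$ has at most one parent; if $\delta_{p(v)}\in\{\mathsf n,\mathsf u\}$, $v$ has at most one child; if $\delta_{p(v)}\in\{\mathsf u,\mathsf{ud}\}$, $v$ has at most one parent $u$ with $p(u)<p(v)$, and if it exists every ancestor $u'$ of $u$ has $p(u')<p(v)$, and likewise $v$ has at most one parent $u$ with $p(u)>p(v)$, and if it exists every ancestor $u'$ of $u$ has $p(u')>p(v)$; if $\delta_{p(v)}\in\{\mathsf d,\mathsf{ud}\}$, $v$ has at most one child $u$ with $p(u)<p(v)$, and if it exists every descendant $u'$ of $u$ has $p(u')<p(v)$, and likewise $v$ has at most one child $u$ with $p(u)>p(v)$,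 and if it exists every descendant $u'$ of $u$ has $p(u')>p(v)$. $V(T)$ is partially ordered by $u\preceq v$ iff there is a directed path (possibly trivial) from $u$ to $v$. A linear extension of $V(T)$ is a bijection $\sigma:V(T)\to[n]$ with $\sigma(x)\le\sigma(y)$ whenever $x\preceq y$. A decreasing $\delta$-permutree is a pair $\mathcal T=(T,\sigma)$ with $T$ a $\delta$-permutree and $\sigma$ a linear extension of $V(T)$. In-order reading. $\mathcal I_\delta(T,\sigma)=\sigma\circ p^{ -1}\in S_n$. By a theorem of Pilaud and Pons, $\mathcal I_\delta$ is a bijection from decreasing $\delta$-permutrees to $S_n$. If $\mathcal I_\delta(T,\sigma)=w$, then for $i<j$ the vertices $p^{ -1}(i),p^{ -1}(j)$ are $\preceq$-comparable if and only if they are not separated by a wall, i.e. there is no $k$ with $i<k<j$ such that [$\delta_k\in\{\mathsf u,\mathsf{ud}\}$ and $w(k)<\min\{w(i),w(j)\}$] or [$\delta_k\in\{\mathsf d,\mathsf{ud}\}$ and $w(k)>\max\{w(i),w(j)\}$]. Congruence and operator. Write $\mathrm{skel}_\delta(w)=T$ if $\mathcal I_\delta^{ -1}(w)=(T,\sigma)$. The $\delta$-permutree congruence is $v\equiv_\delta w\iff\mathrm{skel}_\delta(v)=\mathrm{skel}_\delta(w)$ (same tree with same labeling $p$); by Pilaud and Pons it is a lattice congruence on the left weak order of $S_n$ ($x\le_L y\iff\ell(yx^{ -1})=\ell(y)-\ell(x)$). Let $\pi_\downarrow^{\equiv_\delta}(w)$ be the $\le_L$-minimal element of the class of $w$. The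 permutree stack-sorting operator is $\mathbf S_{\equiv_\delta}(w)=w\,(\pi_\downarrow^{\equiv_\delta}(w))^{ -1}$. Postorder reading. The postorder of $V(T)$ is the unique linear extension $\sigma_{\mathrm{post}}:V(T)\to[n]$ such that $\sigma_{\mathrm{post}}(x)<\sigma_{\mathrm{post}}(y)$ whenever $x,y$ are $\preceq$-incomparable and $p(x)<p(y)$. The postorder reading of a decreasing permutree $\mathcal T=(T,\sigma)$ is $\mathcal P(\mathcal T)=\sigma\circ\sigma_{\mathrm{post}}^{ -1}\in S_n$. -}

module Defs where

open import Level using (0ℓ; suc)
open import Data.Bool using (Bool; true; false)
open import Data.Nat using (ℕ; _+_)
open import Data.Fin using (Fin; _<_; _≤_; _<?_)
open import Data.Fin.Permutation using (Permutation′; _⟨$⟩ʳ_; _≈_)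
open import Data.List using (_∷_; _∷ʳ_; length; filter; allFin; cartesianProduct)
open import Data.List.Relation.Unary.Linked using (Linked)
open import Data.List.Relation.Unary.Unique.Propositional using (Unique)
open import Data.Product using (Σ; ∃; ∃!; _×_; _,_)
open import Data.Vec using (Vec; lookup)
open import Function using (_↔_; _⇔_; Inverse)
open import Function.Construct.Composition using (_↔-∘_)
open import Function.Construct.Symmetry using (↔-sym)
open import Relation.Binary using (Rel; REL; Decidable; Asymmetric)
open import Relation.Binary.Construct.Closure.Equivalence using (EqClosure)
open import Relation.Binary.Construct.Closure.ReflexiveTransitive using (Star)
open import Relation.Binary.Construct.Closure.Symmetric using (SymClosure)
open import Relation.Binary.Construct.Closure.Transitive using (TransClosure)
open import Relation.Binary.PropositionalEquality using (_≡_)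
open import Relation.Nullary using (¬_)
open import Relation.Nullary.Decidable using (_×-dec_)

open Inverse using (to)

data Decoration : Set where
  n u d ud : Decoration

hasUp : Decoration → Bool
hasUp n  = false
hasUp u  = true
hasUp d  = false
hasUp ud = true

hasDown : Decoration → Bool
hasDown n  = false
hasDown u  = false
hasDown d  = true
hasDown ud = true

-- An oriented tree: asymmetry excludes loops and antiparallel arrows, so the
-- underlying undirected graph is simple, and it is connected without cycles.
record IsDirectedTree {V : Set} (_⟶_ : Rel V 0ℓ) : Set where
  field
    asymmetric : Asymmetric _⟶_
    connected  : ∀ x y → EqClosure _⟶_ x y
    acyclic    : ∀ x y z zs → Unique (x ∷ y ∷ z ∷ zs) →
                 ¬ Linked (SymClosure _⟶_) (x ∷ y ∷ z ∷ (zs ∷ʳ x))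

-- The planar embedding is the one read off from p: the parents of a vertex, and
-- likewise its children, are ordered from left to right by label. It is
-- therefore not separate data.
record Permutree {m : ℕ} (δ : Vec Decoration m) : Set (suc 0ℓ) where
  infix 4 _⟶_ _⟶⁺_ _⪯_
  field
    V      : Set
    _⟶_    : Rel V 0ℓ
    _⟶?_   : Decidable _⟶_
    isTree : IsDirectedTree _⟶_
    p      : V ↔ Fin m

  _⟶⁺_ : Rel V 0ℓ
  _⟶⁺_ = TransClosure _⟶_

  _⪯_ : Rel V 0ℓ
  _⪯_ = Star _⟶_

  deco : V → Decoration
  deco v = lookup δ (to p v)

  -- x is to the left of y
  _◁_ : Rel V 0ℓ
  x ◁ y = to p x < to p y

  -- The parents of v are the a with v ⟶ a; the ancestors of a are the b with a ⟶⁺ b.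
  field
    oneParent        : ∀ {v a b} → hasUp (deco v) ≡ false →
                       v ⟶ a → v ⟶ b → a ≡ b
    oneLeftParent    : ∀ {v a b} → hasUp (deco v) ≡ true →
                       v ⟶ a → a ◁ v → v ⟶ b → b ◁ v → a ≡ b
    oneRightParent   : ∀ {v a b} → hasUp (deco v) ≡ true →
                       v ⟶ a → v ◁ a → v ⟶ b → v ◁ b → a ≡ b
    leftAncestors    : ∀ {v a b} → hasUp (deco v) ≡ true →
                       v ⟶ a → a ◁ v → a ⟶⁺ b → b ◁ v
    rightAncestors   : ∀ {v a b} → hasUp (deco v) ≡ true →
                       v ⟶ a → v ◁ a → a ⟶⁺ b → v ◁ b

    oneChild         : ∀ {v a b} → hasDown (deco v) ≡ false →
                       a ⟶ v → b ⟶ v → a ≡ b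
    oneLeftChild     : ∀ {v a b} → hasDown (deco v) ≡ true →
                       a ⟶ v → a ◁ v → b ⟶ v → b ◁ v → a ≡ b
    oneRightChild    : ∀ {v a b} → hasDown (deco v) ≡ true →
                       a ⟶ v → v ◁ a → b ⟶ v → v ◁ b → a ≡ b
    leftDescendants  : ∀ {v a b} → hasDown (deco v) ≡ true →
                       a ⟶ v → a ◁ v → b ⟶⁺ a → b ◁ v
    rightDescendants : ∀ {v a b} → hasDown (deco v) ≡ true →
                       a ⟶ v → v ◁ a → b ⟶⁺ a → v ◁ b

  IsLinearExtension : V ↔ Fin m → Set
  IsLinearExtension σ = ∀ {x y} → x ⪯ y → to σ x ≤ to σ y

  IsPostorder : V ↔ Fin m → Set
  IsPostorder τ = IsLinearExtension τ ×
    (∀ {x y} → ¬ (x ⪯ y) → ¬ (y ⪯ x) → x ◁ y → to τ x < to τ y)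

-- Same tree with the same labelling: an isomorphism of directed trees
-- compatible with the labellings p.
_≅_ : ∀ {m} {δ : Vec Decoration m} → Rel (Permutree δ) 0ℓ
T ≅ T′ = Σ (T.V ↔ T′.V) λ φ →
    (∀ x → to T′.p (to φ x) ≡ to T.p x)
  × (∀ x y → (x T.⟶ y) ⇔ (to φ x T′.⟶ to φ y))
  where module T = Permutree T
        module T′ = Permutree T′

record DecreasingPermutree {m : ℕ} (δ : Vec Decoration m) : Set (suc 0ℓ) where
  field
    tree : Permutree δ
  open Permutree tree public
  field
    σ         : V ↔ Fin m
    σ-linear  : IsLinearExtension σ

-- Permutations multiply as functions: (v ↔-∘ w) i = v (w i).

𝓘 : ∀ {m} {δ : Vec Decoration m} → DecreasingPermutree δ → Permutation′ m
𝓘 𝒯 = σ ↔-∘ ↔-sym p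
  where open DecreasingPermutree 𝒯

ℓ : ∀ {m} → Permutation′ m → ℕ
ℓ {m} w = length (filter (λ (i , j) → (i <? j) ×-dec (w ⟨$⟩ʳ j <? w ⟨$⟩ʳ i))
                         (cartesianProduct (allFin m) (allFin m)))

-- ℓ(yx⁻¹) = ℓ(y) − ℓ(x), stated without truncated subtraction.
_≤L_ : ∀ {m} → Rel (Permutation′ m) 0ℓ
x ≤L y = ℓ (y ↔-∘ ↔-sym x) + ℓ x ≡ ℓ y

-- The maps below involve inverses and choices of distinguished elements that
-- are determined uniquely but not by a formula, so each of them is given by its
-- graph: F w v reads "F(w) = v".

𝓘⁻¹ : ∀ {m} (δ : Vec Decoration m) → REL (Permutation′ m) (DecreasingPermutree δ) 0ℓ
𝓘⁻¹ δ w 𝒯 = 𝓘 𝒯 ≈ w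

skel : ∀ {m} (δ : Vec Decoration m) → REL (Permutation′ m) (Permutree δ) (suc 0ℓ)
skel δ w T = ∃ λ 𝒯 → 𝓘⁻¹ δ w 𝒯 × DecreasingPermutree.tree 𝒯 ≅ T

_≡[_]_ : ∀ {m} → Permutation′ m → Vec Decoration m → Permutation′ m → Set (suc 0ℓ)
v ≡[ δ ] w = ∃ λ T → skel δ v T × skel δ w T

π↓ : ∀ {m} (δ : Vec Decoration m) → Rel (Permutation′ m) (suc 0ℓ)
π↓ δ w π = π ≡[ δ ] w × (∀ v → v ≡[ δ ] w → v ≤L π → v ≈ π)

𝐒 : ∀ {m} (δ : Vec Decoration m) → Rel (Permutation′ m) (suc 0ℓ)
𝐒 δ w v = ∃ λ π → π↓ δ w π × w ↔-∘ ↔-sym π ≈ v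

𝓟 : ∀ {m} {δ : Vec Decoration m} → REL (DecreasingPermutree δ) (Permutation′ m) 0ℓ
𝓟 𝒯 v = ∃ λ τ → IsPostorder τ × σ ↔-∘ ↔-sym τ ≈ v
  where open DecreasingPermutree 𝒯

𝓟∘𝓘⁻¹ : ∀ {m} (δ : Vec Decoration m) → Rel (Permutation′ m) (suc 0ℓ)
𝓟∘𝓘⁻¹ δ w v = ∃ λ 𝒯 → 𝓘⁻¹ δ w 𝒯 × 𝓟 𝒯 v

-- F is the graph of a map from S_m to itself.
IsMap : ∀ {m a} → Rel (Permutation′ m) a → Set a
IsMap F = ∀ w → ∃! _≈_ (F w)

{-# OPTIONS --safe #-}

-- A non-backtracking walk in a permutree that turns at a vertex s, from going
-- up to going down or conversely, turns at a wall of s and stays on the far side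
-- of s from then on. Hence an arrow a ⟶ b can only pass over a vertex t below a
-- or above b, and a pair a ⪯ b only over t with t ⪯ b or a ⪯ t. The first fact
-- makes the tree order depend only on the in-order reading w; the second makes
-- "x ≺ y, or x and y are incomparable and x is left of y" a linear order, so
-- that the postorder exists. The in-order readings of the linear extensions of a
-- tree form its class; the inversions of the postorder are the inversions forced
-- by the tree, so its reading is the least element of the class, and multiplying
-- w = σ p⁻¹ by the inverse of σ_post p⁻¹ leaves σ σ_post⁻¹.
--
-- A tree with reading w is obtained by joining b to the highest vertex it sees
-- below itself, in each of the regions cut out by a downward wall of b.
module Submission where

open import Defs
open import Level using (0ℓ)
open import Data.Bool using (Bool; true; false; if_then_else_)
import Data.Bool.Properties as Bool
open import Data.Empty using (⊥; ⊥-elim)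
open import Data.Nat as ℕ using (ℕ; _+_)
import Data.Nat.Properties as ℕ
open import Data.Fin using (Fin; zero; suc; toℕ; fromℕ<; inject₁; punchOut; _<_; _≤_)
open import Data.Fin.Induction using (spo-wellFounded; spo-noetherian; <-weakInduction)
open import Data.Fin.Permutation
  using (Permutation′; permutation; _⟨$⟩ʳ_; _⟨$⟩ˡ_; inverseˡ; inverseʳ; _≈_)
open import Data.Fin.Properties
  using (_≟_; _<?_; <-cmp; <-trans; <-asym; <-irrefl; ≤-refl; ≤-trans; ≤-antisym; any?; all?;
         toℕ-injective; toℕ-inject₁; toℕ-fromℕ<; punchOut-injective; injective⇒≤)
open import Data.Fin.Subset using (Subset; _∈_; ∣_∣)
open import Data.Fin.Subset.Properties using (p⊂q⇒∣p∣<∣q∣; ∣⊤∣≡n; ∈⊤)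
open import Data.List as List using (List; []; _∷_; _∷ʳ_; _++_; length; filter; allFin; cartesianProduct)
import Data.List.Membership.Propositional as List∈
open import Data.List.Membership.Propositional.Properties using (∈-allFin; ∈-cartesianProduct⁺; ∈-filter⁺)
open import Data.List.Properties using (length-++; filter-++; map-tabulate)
open import Data.List.Relation.Unary.All using (All; []; _∷_)
open import Data.List.Relation.Unary.AllPairs using ([]; _∷_)
open import Data.List.Relation.Unary.Any using (here; there)
open import Data.List.Relation.Unary.Linked using (Linked; []; [-]; _∷_)
open import Data.List.Relation.Unary.Unique.Propositional using (Unique)
open import Data.Product using (∃; _×_; _,_; proj₁; proj₂)
open import Data.Sum using (_⊎_; inj₁; inj₂; swap; map₂; [_,_]′)
open import Data.Vec as Vec using (Vec; lookup)
open import Data.Vec.Properties using (lookup∘tabulate; lookup⇒[]=; []=⇒lookup)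
open import Function using (flip; id; _∘_; _↔_; _⇔_; mk⇔; Inverse; Equivalence; Injective)
open import Function.Construct.Composition using (_↔-∘_)
open import Function.Construct.Identity using (↔-id)
open import Function.Construct.Symmetry using (↔-sym)
open import Induction.WellFounded using (Acc; acc)
open import Relation.Binary
  using (Rel; Decidable; Trichotomous; Tri; IsStrictPartialOrder; IsStrictTotalOrder; tri<; tri≈; tri>)
open import Relation.Binary.Construct.Closure.Equivalence as EqC using (EqClosure)
open import Relation.Binary.Construct.Closure.ReflexiveTransitive as Star using (Star; ε; _◅_; _◅◅_; reverse)
open import Relation.Binary.Construct.Closure.Symmetric using (SymClosure; fwd; bwd)
open import Relation.Binary.Construct.Closure.Transitive using (TransClosure; [_]; _∷_)
import Relation.Binary.Construct.Flip.EqAndOrd as Flip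
open import Relation.Binary.PropositionalEquality
  using (_≡_; _≢_; refl; sym; trans; subst; subst₂; cong; cong₂; isEquivalence; resp₂; module ≡-Reasoning)
open import Relation.Binary.Structures.Biased using (isStrictTotalOrderᶜ)
open import Relation.Nullary using (¬_; Dec; yes; no; does)
open import Relation.Nullary.Decidable using (_×-dec_; _⊎-dec_; _→-dec_; ¬?; map′; dec-true)
open import Relation.Unary as Unary using (Pred)
open import Algebra.Properties.CommutativeMonoid.Sum ℕ.+-0-commutativeMonoid
  using (sum; sum-cong-≗; ∑-distrib-+; sum-permute)

open Inverse using (to; from; strictlyInverseˡ; strictlyInverseʳ)

-- Positions on a line

Between : ∀ {m} → Fin m → Fin m → Fin m → Set
Between a k b = (a < k × k < b) ⊎ (b < k × k < a)

-- Two implications, so the relation is vacuous when `a` is `s`; it is symmetric once both points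
-- differ from `s`.
SameSide : ∀ {m} → Fin m → Fin m → Fin m → Set
SameSide s a b = (a < s → b < s) × (s < a → s < b)

between-irrefl : ∀ {m} {a k : Fin m} → ¬ Between a k a
between-irrefl (inj₁ (a<k , k<a)) = <-asym a<k k<a
between-irrefl (inj₂ (a<k , k<a)) = <-asym a<k k<a

between-irreflˡ : ∀ {m} {a b : Fin m} → ¬ Between a a b
between-irreflˡ (inj₁ (a<a , _)) = <-irrefl refl a<a
between-irreflˡ (inj₂ (_ , a<a)) = <-irrefl refl a<a

between-irreflʳ : ∀ {m} {a b : Fin m} → ¬ Between a b b
between-irreflʳ = between-irreflˡ ∘ swap

between-sameSide : ∀ {m} {a k b c : Fin m} → SameSide k b c → Between a k b → Between a k c
between-sameSide (_ , r) (inj₁ (a<k , k<b)) = inj₁ (a<k , r k<b)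
between-sameSide (l , _) (inj₂ (b<k , k<a)) = inj₂ (l b<k , k<a)

between⇒¬sameSide : ∀ {m} {a k b : Fin m} → Between a k b → ¬ SameSide k a b
between⇒¬sameSide (inj₁ (a<k , k<b)) (l , _) = <-asym (l a<k) k<b
between⇒¬sameSide (inj₂ (b<k , k<a)) (_ , r) = <-asym b<k (r k<a)

between-trans : ∀ {m} {x s k b : Fin m} → Between x s k → Between s k b → Between x k b
between-trans (inj₁ (x<s , s<k)) (inj₁ (_ , k<b))   = inj₁ (<-trans x<s s<k , k<b)
between-trans (inj₁ (_ , s<k))   (inj₂ (_ , k<s))   = ⊥-elim (<-asym s<k k<s)
between-trans (inj₂ (k<s , _))   (inj₁ (s<k , _))   = ⊥-elim (<-asym k<s s<k)
between-trans (inj₂ (k<s , s<x)) (inj₂ (b<k , _))   = inj₂ (b<k , <-trans k<s s<x)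

between-asymˡ : ∀ {m} {x s b : Fin m} → Between x s b → ¬ Between s x b
between-asymˡ (inj₁ (x<s , _))   (inj₁ (s<x , _))   = <-asym x<s s<x
between-asymˡ (inj₁ (x<s , s<b)) (inj₂ (b<x , _))   = <-asym (<-trans x<s s<b) b<x
between-asymˡ (inj₂ (b<s , s<x)) (inj₁ (_ , x<b))   = <-asym (<-trans b<s s<x) x<b
between-asymˡ (inj₂ (_ , s<x))   (inj₂ (_ , x<s))   = <-asym s<x x<s

between-nested : ∀ {m} {t s a b : Fin m} → SameSide s b a → Between t s b → ¬ Between a t b
between-nested (_ , r) (inj₁ (t<s , s<b)) (inj₁ (a<t , _)) = <-asym (r s<b) (<-trans a<t t<s)
between-nested (_ , _) (inj₁ (t<s , s<b)) (inj₂ (b<t , _)) = <-asym (<-trans t<s s<b) b<t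
between-nested (_ , _) (inj₂ (b<s , s<t)) (inj₁ (_ , t<b)) = <-asym (<-trans b<s s<t) t<b
between-nested (l , _) (inj₂ (b<s , s<t)) (inj₂ (_ , t<a)) = <-asym (l b<s) (<-trans s<t t<a)

between-split : ∀ {m} {a c k b : Fin m} → Between a k b → k ≡ c ⊎ Between a k c ⊎ Between c k b
between-split {c = c} {k} btw with <-cmp k c | btw
... | tri≈ _ k≡c _ | _                = inj₁ k≡c
... | tri< k<c _ _ | inj₁ (a<k , _)   = inj₂ (inj₁ (inj₁ (a<k , k<c)))
... | tri< k<c _ _ | inj₂ (b<k , _)   = inj₂ (inj₂ (inj₂ (b<k , k<c)))
... | tri> _ _ c<k | inj₁ (_ , k<b)   = inj₂ (inj₂ (inj₁ (c<k , k<b)))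
... | tri> _ _ c<k | inj₂ (_ , k<a)   = inj₂ (inj₁ (inj₂ (c<k , k<a)))

between-transʳ : ∀ {m} {a c k b : Fin m} → Between a c b → Between c k b → Between a k b
between-transʳ (inj₁ (a<c , _)) (inj₁ (c<k , k<b)) = inj₁ (<-trans a<c c<k , k<b)
between-transʳ (inj₁ (_ , c<b)) (inj₂ (b<k , k<c)) = ⊥-elim (<-asym c<b (<-trans b<k k<c))
between-transʳ (inj₂ (b<c , _)) (inj₁ (c<k , k<b)) = ⊥-elim (<-asym b<c (<-trans c<k k<b))
between-transʳ (inj₂ (_ , c<a)) (inj₂ (b<k , k<c)) = inj₂ (b<k , <-trans k<c c<a)

between-transˡ : ∀ {m} {a c k b : Fin m} → Between a c b → Between a k c → Between a k b
between-transˡ acb akc = swap (between-transʳ (swap acb) (swap akc))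

between⇒sameSide : ∀ {m} {a k b : Fin m} → Between a k b → SameSide b a k
between⇒sameSide (inj₁ (a<k , k<b)) = (λ _ → k<b) , (λ b<a → ⊥-elim (<-asym b<a (<-trans a<k k<b)))
between⇒sameSide (inj₂ (b<k , k<a)) = (λ a<b → ⊥-elim (<-asym a<b (<-trans b<k k<a))) , (λ _ → b<k)

between⇒sameSide′ : ∀ {m} {a k b : Fin m} → Between a k b → SameSide b k a
between⇒sameSide′ (inj₁ (a<k , k<b)) = (λ _ → <-trans a<k k<b) , (λ b<k → ⊥-elim (<-asym b<k k<b))
between⇒sameSide′ (inj₂ (b<k , k<a)) = (λ k<b → ⊥-elim (<-asym b<k k<b)) , (λ _ → <-trans b<k k<a)

between? : ∀ {m} (a k b : Fin m) → Dec (Between a k b)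
between? a k b = (a <? k ×-dec k <? b) ⊎-dec (b <? k ×-dec k <? a)

sameSide? : ∀ {m} (s a b : Fin m) → Dec (SameSide s a b)
sameSide? s a b = (a <? s →-dec b <? s) ×-dec (s <? a →-dec s <? b)

sameSide-trans : ∀ {m} {s a b c : Fin m} → SameSide s a b → SameSide s b c → SameSide s a c
sameSide-trans (l , r) (l′ , r′) = l′ ∘ l , r′ ∘ r

sameSide-or-between : ∀ {m} {s a b : Fin m} → a ≢ s → b ≢ s → SameSide s a b ⊎ Between a s b
sameSide-or-between {s = s} {a} {b} a≢s b≢s with <-cmp a s | <-cmp b s
... | tri≈ _ a≡s _ | _            = ⊥-elim (a≢s a≡s)
... | _            | tri≈ _ b≡s _ = ⊥-elim (b≢s b≡s)
... | tri< a<s _ _ | tri< b<s _ _ = inj₁ ((λ _ → b<s) , (λ s<a → ⊥-elim (<-asym s<a a<s)))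
... | tri< a<s _ _ | tri> _ _ s<b = inj₂ (inj₁ (a<s , s<b))
... | tri> _ _ s<a | tri< b<s _ _ = inj₂ (inj₂ (b<s , s<a))
... | tri> _ _ s<a | tri> _ _ s<b = inj₁ ((λ a<s → ⊥-elim (<-asym a<s s<a)) , (λ _ → s<b))

sameSide⇒nested : ∀ {m} {s a b : Fin m} → a ≢ b → a ≢ s → SameSide s a b → Between s a b ⊎ Between s b a
sameSide⇒nested {s = s} {a} {b} a≢b a≢s (l , r) with <-cmp a s | <-cmp a b
... | tri≈ _ a≡s _ | _            = ⊥-elim (a≢s a≡s)
... | _            | tri≈ _ a≡b _ = ⊥-elim (a≢b a≡b)
... | tri< a<s _ _ | tri< a<b _ _ = inj₂ (inj₂ (a<b , l a<s))
... | tri< a<s _ _ | tri> _ _ b<a = inj₁ (inj₂ (b<a , a<s))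
... | tri> _ _ s<a | tri< a<b _ _ = inj₁ (inj₁ (s<a , a<b))
... | tri> _ _ s<a | tri> _ _ b<a = inj₂ (inj₁ (r s<a , b<a))

-- The order "closer to `b`, on the same side"; its well-foundedness drives the descent in
-- `nearest`.
between-isStrictPartialOrder : ∀ {m} (b : Fin m) → IsStrictPartialOrder _≡_ (λ k c → Between c k b)
between-isStrictPartialOrder b = record
  { isEquivalence = isEquivalence
  ; irrefl        = λ { refl → between-irreflˡ }
  ; trans         = λ ckb eck → between-transʳ eck ckb
  ; <-resp-≈      = resp₂ _
  }

-- Walks in a tree with walls

-- Stated for one direction only: it is used with upward walls along the arrows and with downward
-- walls along the reversed arrows, so that ancestors and descendants share every argument.
record Walls {m} (wall : Fin m → Bool) (_⟶_ : Rel (Fin m) 0ℓ) : Set where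
  field
    apart : ∀ {v a b} → v ⟶ a → v ⟶ b → a ≢ b → wall v ≡ true × Between a v b
    left  : ∀ {v a b} → wall v ≡ true → v ⟶ a → a < v → Star _⟶_ a b → b < v
    right : ∀ {v a b} → wall v ≡ true → v ⟶ a → v < a → Star _⟶_ a b → v < b
    loopless : ∀ {v a} → v ⟶ a → a ≢ v

-- A non-backtracking walk from x whose last arrow is c ⟶ y and whose last
-- turn, if there is one, is the wall s; the walk never crosses its turns again.
Arrives : ∀ {m} → (Fin m → Bool) → Rel (Fin m) 0ℓ → Fin m → Fin m → Fin m → Set
Arrives wall _⟶_ x c y =
  c ⟶ y × ∃ λ s → Star _⟶_ s c × (s ≡ x ⊎ wall s ≡ true × Between x s y)

module _ {m} {wall : Fin m → Bool} {_⟶_ : Rel (Fin m) 0ℓ} (W : Walls wall _⟶_) where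
  open Walls W

  sameSide : ∀ {s e y z} → wall s ≡ true → s ⟶ e → Star _⟶_ e y → Star _⟶_ e z →
             SameSide s y z
  sameSide {s} {e} ws se ey ez with <-cmp e s
  ... | tri< e<s _ _ = (λ _ → left ws se e<s ez) , (λ s<y → ⊥-elim (<-asym s<y (left ws se e<s ey)))
  ... | tri≈ _ e≡s _ = ⊥-elim (loopless se e≡s)
  ... | tri> _ _ s<e = (λ y<s → ⊥-elim (<-asym y<s (right ws se s<e ey))) , (λ _ → right ws se s<e ez)

  -- The last turn `s` stays the same, and `y` and `z` are reached through the same arrow out of
  -- `s`, hence lie on the same side of its wall.
  arrives-straight : ∀ {x c y z} → Arrives wall _⟶_ x c y → y ⟶ z → Arrives wall _⟶_ x y z
  arrives-straight (cy , s , sc , inj₁ s≡x) yz = yz , s , (sc ◅◅ cy ◅ ε) , inj₁ s≡x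
  arrives-straight (cy , s , sc , inj₂ (ws , btw)) yz =
    yz , s , (sc ◅◅ cy ◅ ε) , inj₂ (ws , between-sameSide (side sc) btw)
    where
    side : Star _⟶_ s _ → SameSide s _ _
    side ε         = sameSide ws cy ε (yz ◅ ε)
    side (se ◅ ec) = sameSide ws se (ec ◅◅ cy ◅ ε) (ec ◅◅ cy ◅ yz ◅ ε)

  -- If the walk has a last turn `s`, then `s` separates `t` from `b`, and `a` is either `s` itself
  -- or on the side of `b`; in both cases `t` is outside the span of the arrow. So the walk is
  -- straight, and a wall at `t` would keep `a` and `b` on one side of it.
  arrives-crossing : ∀ {t a b} → Arrives wall _⟶_ t a b → Between a t b →
                     Star _⟶_ t a × wall t ≢ true
  arrives-crossing (ab , s , sa , inj₁ refl) btw = sa , λ wt → noWall wt sa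
    where
    noWall : wall s ≡ true → ¬ Star _⟶_ s _
    noWall wt ε         = between-irreflˡ btw
    noWall wt (se ◅ ea) = between⇒¬sameSide btw (sameSide wt se ea (ea ◅◅ ab ◅ ε))
  arrives-crossing (ab , s , ε , inj₂ (_ , btw′)) btw = ⊥-elim (between-asymˡ btw btw′)
  arrives-crossing (ab , s , se ◅ ea , inj₂ (ws , btw′)) btw =
    ⊥-elim (between-nested (sameSide ws se (ea ◅◅ ab ◅ ε) ea) btw′ btw)

-- `c` and `z` are distinct children of `y`, which therefore has a wall between them. The previous
-- turn `s` lies below `c`, so this wall also separates `s` from `z`, and with it everything that
-- `s` cuts off from `y`. The opposite turn is the same lemma for the reversed arrows.
arrives-turn : ∀ {m} {above below : Fin m → Bool} {_⟶_ : Rel (Fin m) 0ℓ} →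
               Walls below (flip _⟶_) → ∀ {x c y z} →
               Arrives above _⟶_ x c y → z ⟶ y → z ≢ c → Arrives below (flip _⟶_) x y z
arrives-turn {_⟶_ = _⟶_} B {x} {c} {y} {z} (cy , s , sc , start) zy z≢c =
  zy , y , ε , inj₂ (proj₁ walled , beyond start)
  where
  open Walls B
  walled = apart cy zy (z≢c ∘ sym)
  s-side : Between s y z
  s-side = swap (between-sameSide (sameSide B (proj₁ walled) cy ε (reverse id sc)) (swap (proj₂ walled)))
  beyond : s ≡ x ⊎ _ × Between x s y → Between x y z
  beyond (inj₁ refl)      = s-side
  beyond (inj₂ (_ , btw)) = between-trans btw s-side

-- In every use `level` is an in-order reading. A common `level` is what makes two trees comparable
-- in `arrow⇒path`.
record Walled {m} (up down : Fin m → Bool) (level : Fin m → Fin m) (_⟶_ : Rel (Fin m) 0ℓ) : Set where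
  field
    above  : Walls up _⟶_
    below  : Walls down (flip _⟶_)
    rising : ∀ {a b} → a ⟶ b → level a < level b

  rising* : ∀ {a b} → Star _⟶_ a b → level a ≤ level b
  rising* ε         = ≤-refl
  rising* (ab ◅ bc) = ≤-trans (ℕ.<⇒≤ (rising ab)) (rising* bc)

  -- The middle index is the vertex before the last one, which the next step has to avoid.
  data Walk (x : Fin m) : Fin m → Fin m → Set where
    start : ∀ {y} → SymClosure _⟶_ x y → Walk x x y
    step  : ∀ {c y z} → Walk x c y → SymClosure _⟶_ y z → z ≢ c → Walk x y z

  Arrives± : Fin m → Fin m → Fin m → Set
  Arrives± x c y = Arrives up _⟶_ x c y ⊎ Arrives down (flip _⟶_) x c y

  arrives : ∀ {x c y} → Walk x c y → Arrives± x c y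
  arrives (start (fwd xy)) = inj₁ (xy , _ , ε , inj₁ refl)
  arrives (start (bwd yx)) = inj₂ (yx , _ , ε , inj₁ refl)
  arrives (step w yz z≢c) with arrives w | yz
  ... | inj₁ asc  | fwd y→z = inj₁ (arrives-straight above asc y→z)
  ... | inj₁ asc  | bwd z→y = inj₂ (arrives-turn below asc z→y z≢c)
  ... | inj₂ desc | fwd y→z = inj₁ (arrives-turn above desc y→z z≢c)
  ... | inj₂ desc | bwd z→y = inj₂ (arrives-straight below desc z→y)

  -- A walk without turns changes `level` strictly monotonically; a walk with turns ends on the far
  -- side of its last turn, which would separate `x` from itself.
  noClosedWalk : ∀ {x c} → ¬ Walk x c x
  noClosedWalk w with arrives w
  ... | inj₁ (cx , _ , xc , inj₁ refl)      = <-irrefl refl (ℕ.<-≤-trans (rising cx) (rising* xc))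
  ... | inj₂ (xc , _ , cx , inj₁ refl)      = <-irrefl refl (ℕ.<-≤-trans (rising xc) (rising* (reverse id cx)))
  ... | inj₁ (_ , _ , _ , inj₂ (_ , btw)) = between-irrefl btw
  ... | inj₂ (_ , _ , _ , inj₂ (_ , btw)) = between-irrefl btw

  acyclic : ∀ x y z zs → Unique (x ∷ y ∷ z ∷ zs) →
            ¬ Linked (SymClosure _⟶_) (x ∷ y ∷ z ∷ (zs ∷ʳ x))
  acyclic x y z zs ((x≢y ∷ x≢z ∷ x∉zs) ∷ unique) (xy ∷ yz ∷ links) =
    close y z zs (step (start xy) yz (x≢z ∘ sym)) unique x≢y (x≢z ∷ x∉zs) links
    where
    close : ∀ c y zs → Walk x c y → Unique (c ∷ y ∷ zs) → x ≢ c → All (x ≢_) (y ∷ zs) →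
            ¬ Linked (SymClosure _⟶_) (y ∷ (zs ∷ʳ x))
    close c y []       w _ x≢c _ (yx ∷ [-]) = noClosedWalk (step w yx x≢c)
    close c y (z ∷ zs) w ((_ ∷ c≢z ∷ _) ∷ unique) x≢c (x≢y ∷ x∉) (yz ∷ links) =
      close y z zs (step w yz (c≢z ∘ sym)) unique x≢y x∉ links

  module Connected (connected : ∀ x y → EqClosure _⟶_ x y) where

    Reached : Fin m → Fin m → Set
    Reached x y = x ≡ y ⊎ ∃ λ c → Walk x c y

    -- A step back to `c` is made by dropping the last step, so backtracking disappears from any
    -- path.
    reached-step : ∀ {x y z} → Reached x y → SymClosure _⟶_ y z → Reached x z
    reached-step (inj₁ refl) yz = inj₂ (_ , start yz)
    reached-step {z = z} (inj₂ (c , w)) yz with z ≟ c | w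
    ... | no z≢c   | _            = inj₂ (_ , step w yz z≢c)
    ... | yes refl | start _      = inj₁ refl
    ... | yes refl | step w′ _ _  = inj₂ (_ , w′)

    reach : ∀ {x y z} → Reached x y → EqClosure _⟶_ y z → Reached x z
    reach r ε         = r
    reach r (yz ◅ zs) = reach (reached-step r yz) zs

    reached : ∀ x y → Reached x y
    reached x y = reach (inj₁ refl) (connected x y)

    -- Walk from `t` to `a`. If the last step does not come from `b`, the walk extends to `b` and
    -- ends with the arrow upwards; if it does, it ends with the arrow downwards. `arrives-crossing`
    -- covers both.
    crossing : ∀ {a b t} → a ⟶ b → Between a t b →
               (Star _⟶_ t a × up t ≢ true) ⊎ (Star _⟶_ b t × down t ≢ true)
    crossing {a} {b} {t} ab btw with reached t a
    ... | inj₁ refl = ⊥-elim (between-irreflˡ btw)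
    ... | inj₂ (c , w) with b ≟ c
    ... | no b≢c with arrives (step w (fwd ab) b≢c)
    ...   | inj₁ asc      = inj₁ (arrives-crossing above asc btw)
    ...   | inj₂ (ba , _) = ⊥-elim (<-asym (rising ab) (rising ba))
    crossing {a} {b} {t} ab btw | inj₂ (c , w) | yes refl with arrives w
    ...   | inj₁ (ba , _) = ⊥-elim (<-asym (rising ab) (rising ba))
    ...   | inj₂ desc     with arrives-crossing below desc (swap btw)
    ...     | tb , ¬down = inj₂ (reverse id tb , ¬down)

    -- Either `z` lies on the path, or one of its arrows passes over `z` and `crossing` applies to
    -- that arrow.
    comparable-between : ∀ {x y z} → Star _⟶_ x y → Between x z y → Star _⟶_ z y ⊎ Star _⟶_ x z
    comparable-between ε btw = ⊥-elim (between-irrefl btw)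
    comparable-between (_◅_ {j = x′} xx′ x′y) btw with between-split {c = x′} btw
    ... | inj₁ refl         = inj₁ x′y
    ... | inj₂ (inj₂ btw′) = map₂ (xx′ ◅_) (comparable-between x′y btw′)
    ... | inj₂ (inj₁ btw′) with crossing xx′ btw′
    ...   | inj₁ (zx , _)  = inj₁ (zx ◅◅ xx′ ◅ x′y)
    ...   | inj₂ (x′z , _) = inj₂ (xx′ ◅ x′z)

-- By the crossing lemma, an arrow a ⟶ b of one tree has no wall that could
-- be the last turn of the walk from a to b in the other tree.
arrow⇒path : ∀ {m} {up down : Fin m → Bool} {level : Fin m → Fin m} {_⟶_ _⟶′_ : Rel (Fin m) 0ℓ} →
  Walled up down level _⟶_ → (∀ x y → EqClosure _⟶_ x y) →
  Walled up down level _⟶′_ → (∀ x y → EqClosure _⟶′_ x y) →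
  ∀ {a b} → a ⟶ b → Star _⟶′_ a b
arrow⇒path {level = level} W con W′ con′ {a} {b} ab = go (reached′ a b)
  where
  open Walled W
  open Connected con
  open Walled W′ using () renaming (arrives to arrives′; rising to rising′; rising* to rising*′; Walk to Walk′)
  open Walled.Connected W′ con′ using () renaming (reached to reached′)
  go : a ≡ b ⊎ (∃ λ c → Walk′ a c b) → Star _ a b
  go (inj₁ refl) = ε
  go (inj₂ (c , w)) with arrives′ w
  ... | inj₁ (cb , s , sc , inj₁ refl) = sc ◅◅ cb ◅ ε
  ... | inj₂ (bc , s , cs , inj₁ refl) =
    ⊥-elim (<-asym (rising ab) (ℕ.<-≤-trans (rising′ bc) (rising*′ (reverse id cs))))
  ... | inj₁ (cb , s , sc , inj₂ (upS , btw)) with crossing ab btw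
  ...   | inj₁ (_ , ¬up) = ⊥-elim (¬up upS)
  -- In the first tree `s` is above `b`, in the second it is below `b`; the common `level` forbids
  -- this.
  ...   | inj₂ (bs , _)  = ⊥-elim (<-irrefl refl (ℕ.≤-<-trans (≤-trans (rising* bs) (rising*′ sc)) (rising′ cb)))
  go (inj₂ (c , w)) | inj₂ (bc , s , cs , inj₂ (downS , btw)) with crossing ab btw
  ...   | inj₂ (_ , ¬down) = ⊥-elim (¬down downS)
  ...   | inj₁ (sa , _)  = ⊥-elim (<-asym (rising ab)
             (ℕ.<-≤-trans (rising′ bc) (≤-trans (rising*′ (reverse id cs)) (rising* sa))))

-- The tree of a permutation

-- Arrows read off from heights ≺: the child of b, in each of the regions into
-- which b divides its surroundings, is the highest vertex below b that b sees,
-- the view being blocked by the walls that reach the height of b.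
module Sight {m} (up down : Fin m → Bool) {_≺_ : Rel (Fin m) 0ℓ} (sto : IsStrictTotalOrder _≡_ _≺_) where
  open IsStrictTotalOrder sto
    using (compare; isStrictPartialOrder)
    renaming (trans to ≺-trans; asym to ≺-asym; irrefl to ≺-irrefl; _<?_ to _≺?_)

  Clear : Fin m → Fin m → Set
  Clear b k = (up k ≡ true → b ≺ k) × (down k ≡ true → k ≺ b)

  Sees : Fin m → Fin m → Set
  Sees b a = a ≺ b × (∀ k → Between a k b → Clear b k)

  Region : Fin m → Fin m → Fin m → Set
  Region b a c = down b ≡ true → SameSide b a c

  IsChild : Fin m → Fin m → Set
  IsChild b a = Sees b a × (∀ c → Sees b c → Region b a c → ¬ a ≺ c)

  sees? : Decidable Sees
  sees? b a = a ≺? b ×-dec all? λ k → between? a k b →-dec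
    ((up k Bool.≟ true →-dec b ≺? k) ×-dec (down k Bool.≟ true →-dec k ≺? b))

  region? : ∀ b a c → Dec (Region b a c)
  region? b a c = down b Bool.≟ true →-dec sameSide? b a c

  isChild? : Decidable IsChild
  isChild? b a = sees? b a ×-dec all? λ c → sees? b c →-dec (region? b a c →-dec ¬? (a ≺? c))

  region-trans : ∀ {b a c e} → Region b a c → Region b c e → Region b a e
  region-trans r r′ wb = sameSide-trans (r wb) (r′ wb)

  sees-between : ∀ {b a c} → Sees b a → Between a c b → c ≺ b → Sees b c
  sees-between (_ , clear) acb c≺b = c≺b , λ k ckb → clear k (between-transʳ acb ckb)

  equal-height : ∀ {a b} → ¬ a ≺ b → ¬ b ≺ a → a ≡ b
  equal-height {a} {b} a⊀b b⊀a with compare a b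
  ... | tri< a≺b _ _ = ⊥-elim (a⊀b a≺b)
  ... | tri≈ _ a≡b _ = a≡b
  ... | tri> _ _ b≺a = ⊥-elim (b⊀a b≺a)

  lower : ∀ {a b} → a ≢ b → ¬ b ≺ a → a ≺ b
  lower {a} {b} a≢b b⊀a with compare a b
  ... | tri< a≺b _ _ = a≺b
  ... | tri≈ _ a≡b _ = ⊥-elim (a≢b a≡b)
  ... | tri> _ _ b≺a = ⊥-elim (b⊀a b≺a)

  -- Two children in one region are both highest there, hence equal. A path descending from `a`
  -- below `v` cannot pass under a downward wall of `v`: this wall reaches the height of every
  -- vertex on the path and blocks its view to the other side.
  child-walls : Walls down IsChild
  child-walls = record
    { apart    = apart
    ; left     = λ wv va a<v → left wv a<v (proj₁ (proj₁ va))
    ; right    = λ wv va v<a → right wv v<a (proj₁ (proj₁ va))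
    ; loopless = λ va a≡v → ≺-irrefl a≡v (proj₁ (proj₁ va))
    }
    where
    apart : ∀ {v a b} → IsChild v a → IsChild v b → a ≢ b → down v ≡ true × Between a v b
    apart {v} {a} {b} ((a≺v , va) , max-a) ((b≺v , vb) , max-b) a≢b with down v Bool.≟ true
    ... | no ¬wv = ⊥-elim (a≢b (equal-height (max-a b (b≺v , vb) (⊥-elim ∘ ¬wv)) (max-b a (a≺v , va) (⊥-elim ∘ ¬wv))))
    ... | yes wv with sameSide-or-between (λ a≡v → ≺-irrefl a≡v a≺v) (λ b≡v → ≺-irrefl b≡v b≺v)
    ...   | inj₂ avb = wv , avb
    ...   | inj₁ ab  = ⊥-elim (a≢b (equal-height (max-a b (b≺v , vb) λ _ → ab) (max-b a (a≺v , va) λ _ → ba)))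
      where
      ba : SameSide v b a
      ba with sameSide-or-between {s = v} {b} {a} (λ b≡v → ≺-irrefl b≡v b≺v) (λ a≡v → ≺-irrefl a≡v a≺v)
      ... | inj₁ ss  = ss
      ... | inj₂ bva = ⊥-elim (between⇒¬sameSide (swap bva) ab)

    not-across : ∀ {v a b} → down v ≡ true → a ≺ v → IsChild a b → ¬ Between b v a
    not-across wv a≺v ((_ , clear) , _) bva = ≺-asym a≺v (proj₂ (clear _ bva) wv)

    left : ∀ {v a b} → down v ≡ true → a < v → a ≺ v → Star IsChild a b → b < v
    left wv a<v a≺v ε = a<v
    left {v} wv a<v a≺v (_◅_ {j = c} ac cb) with <-cmp c v
    ... | tri< c<v _ _  = left wv c<v (≺-trans (proj₁ (proj₁ ac)) a≺v) cb
    ... | tri≈ _ refl _ = ⊥-elim (≺-asym a≺v (proj₁ (proj₁ ac)))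
    ... | tri> _ _ v<c  = ⊥-elim (not-across wv a≺v ac (inj₂ (a<v , v<c)))

    right : ∀ {v a b} → down v ≡ true → v < a → a ≺ v → Star IsChild a b → v < b
    right wv v<a a≺v ε = v<a
    right {v} wv v<a a≺v (_◅_ {j = c} ac cb) with <-cmp c v
    ... | tri> _ _ v<c  = right wv v<c (≺-trans (proj₁ (proj₁ ac)) a≺v) cb
    ... | tri≈ _ refl _ = ⊥-elim (≺-asym a≺v (proj₁ (proj₁ ac)))
    ... | tri< c<v _ _  = ⊥-elim (not-across wv a≺v ac (inj₁ (c<v , v<a)))

  -- If an upward wall starting below `b` hides `c`, replace `c` by the vertex that carries this
  -- wall; it is closer to `b`, so the replacement ends at a visible vertex.
  nearest : ∀ {b c} → c ≺ b → (∀ k → Between c k b → down k ≡ true → k ≺ b) →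
            ∃ λ e → Sees b e × (e ≡ c ⊎ Between c e b × up e ≡ true)
  nearest {b} c≺b = go (spo-wellFounded (between-isStrictPartialOrder b) _) c≺b
    where
    go : ∀ {c} → Acc (λ k c → Between c k b) c → c ≺ b → (∀ k → Between c k b → down k ≡ true → k ≺ b) →
         ∃ λ e → Sees b e × (e ≡ c ⊎ Between c e b × up e ≡ true)
    go {c} (acc rs) c≺b downClear
      with any? (λ k → between? c k b ×-dec (up k Bool.≟ true ×-dec k ≺? b))
    ... | no none = c , (c≺b , λ k ckb →
            (λ wk → lower (λ { refl → between-irreflʳ ckb }) (λ k≺b → none (k , ckb , wk , k≺b))) , downClear k ckb)
          , inj₁ refl
    ... | yes (k , ckb , wk , k≺b) with go (rs ckb) k≺b (λ l klb → downClear l (between-transʳ ckb klb))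
    ...   | e , be , inj₁ refl       = e , be , inj₂ (ckb , wk)
    ...   | e , be , inj₂ (keb , we) = e , be , inj₂ (between-transʳ ckb keb , we)

  highest : ∀ {P : Fin m → Set} → (∀ c → Dec (P c)) → ∀ {a} → P a → ∃ λ c → P c × (∀ e → P e → ¬ c ≺ e)
  highest {P} P? = go (spo-noetherian isStrictPartialOrder _)
    where
    go : ∀ {a} → Acc (flip _≺_) a → P a → ∃ λ c → P c × (∀ e → P e → ¬ c ≺ e)
    go {a} (acc rs) pa with any? (λ e → P? e ×-dec a ≺? e)
    ... | no none            = a , pa , λ e pe a≺e → none (e , pe , a≺e)
    ... | yes (e , pe , a≺e) = go (rs a≺e) pe

  -- The highest vertex `c` that `b` sees in the region of `a` is a child of `b`. If it is not `a`,
  -- then `c` sees `a`: a vertex in the way with a downward wall is visible from `b` in the same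
  -- region, hence lower than `c`, and an upward wall in the way starts above `b`. Induction on the
  -- height of the observer finishes.
  sees⇒connected : ∀ {b a} → Sees b a → EqClosure IsChild b a
  sees⇒connected {b} = go (spo-wellFounded isStrictPartialOrder b)
    where
    go : ∀ {b a} → Acc _≺_ b → Sees b a → EqClosure IsChild b a
    go {b} {a} (acc rs) ba
      with highest (λ c → sees? b c ×-dec region? b a c) (ba , λ _ → id , id)
    ... | c , (bc , rac) , max = fwd (bc , λ e be rce → max e (be , region-trans {b} rac rce)) ◅ c~a (compare c a)
      where
      c~a : _ → EqClosure IsChild c a
      c~a (tri< c≺a _ _)  = ⊥-elim (max a (ba , λ _ → id , id) c≺a)
      c~a (tri≈ _ refl _) = ε
      c~a (tri> _ _ a≺c)  = go (rs (proj₁ bc)) (a≺c , clear)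
        where
        clearVia : ∀ k → Sees b c → Clear b k → (k ≺ b → Sees b k × Region b a k) → k ≢ c → Clear c k
        clearVia k (c≺b , _) (upk , downk) visible k≢c =
          (λ wk → ≺-trans c≺b (upk wk)) ,
          (λ wk → let (bk , rak) = visible (downk wk) in lower k≢c (max k (bk , rak)))
        clear : ∀ k → Between a k c → Clear c k
        clear k akc with between-split {c = b} akc
        -- The vertex in the way is `b`: its upward wall starts above `c`, and a downward wall would
        -- put `a` and `c` into different regions.
        ... | inj₁ refl =
          (λ _ → proj₁ bc) , (λ wb → ⊥-elim (between⇒¬sameSide akc (rac wb)))
        ... | inj₂ (inj₁ akb) = clearVia k bc (proj₂ ba k akb)
          (λ k≺b → sees-between ba akb k≺b , λ _ → between⇒sameSide akb) (λ { refl → between-irreflʳ akc })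
        ... | inj₂ (inj₂ bkc) = clearVia k bc (proj₂ bc k (swap bkc))
          (λ k≺b → sees-between bc (swap bkc) k≺b , region-trans {b} rac (λ _ → between⇒sameSide (swap bkc)))
          (λ { refl → between-irreflʳ akc })

module _ {m} (up down : Fin m → Bool) {_≺_ : Rel (Fin m) 0ℓ} (sto : IsStrictTotalOrder _≡_ _≺_) where
  open IsStrictTotalOrder sto using () renaming (trans to ≺-trans; asym to ≺-asym; irrefl to ≺-irrefl)
  private
    module Below = Sight up down sto
    module Above = Sight down up (Flip.isStrictTotalOrder sto)
  open Below using (IsChild; nearest)

  -- Turning the picture upside down, with heights reversed and the two kinds of walls exchanged,
  -- keeps the arrows. Hence `child-walls` of the reversed picture supplies the upward walls of the
  -- tree.
  child⇒parent : ∀ {a b} → IsChild b a → Above.IsChild a b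
  child⇒parent {a} {b} ((a≺b , clear) , max) = (a≺b , aboveClear) , aboveMin
    where
    aboveClear : ∀ k → Between b k a → Above.Clear a k
    aboveClear k bka =
      (λ wk → Below.lower (λ { refl → between-irreflʳ bka })
                (max k (Below.sees-between (a≺b , clear) (swap bka) (proj₂ (clear k (swap bka)) wk))
                       (λ _ → between⇒sameSide (swap bka)))) ,
      (λ wk → ≺-trans a≺b (proj₁ (clear k (swap bka)) wk))

    -- A vertex c seen from a but lower than b would give b a view of c, or of a
    -- wall in front of c; either is higher than a.
    higher : ∀ {c} → a ≺ c → c ≺ b →
             (∀ k → Between c k b → down k ≡ true → k ≺ b) →
             (∀ k → Between c k b → up k ≡ true → k ≺ b → a ≺ k) →
             Below.Region b a c → ⊥
    higher a≺c c≺b downs ups rac with nearest c≺b downs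
    ... | e , be , inj₁ refl       = max e be rac a≺c
    ... | e , be , inj₂ (ceb , we) =
      max e be (Below.region-trans {b} rac (λ _ → between⇒sameSide ceb)) (ups e ceb we (proj₁ be))

    aboveMin : ∀ c → Above.Sees a c → Above.Region a b c → ¬ c ≺ b
    aboveMin c (a≺c , aboveClear-c) rbc c≺b
      with sameSide-or-between {s = a} {b} {c} (λ { refl → ≺-irrefl refl a≺b }) (λ { refl → ≺-irrefl refl a≺c })
    ... | inj₂ bac = higher a≺c c≺b downs ups (λ _ → between⇒sameSide′ (swap bac))
      where
      downs : ∀ k → Between c k b → down k ≡ true → k ≺ b
      downs k ckb wk with between-split {c = a} ckb
      ... | inj₁ refl       = a≺b
      ... | inj₂ (inj₁ cka) = ≺-trans (proj₁ (aboveClear-c k cka) wk) a≺b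
      ... | inj₂ (inj₂ akb) = proj₂ (clear k akb) wk
      ups : ∀ k → Between c k b → up k ≡ true → k ≺ b → a ≺ k
      ups k ckb wk k≺b with between-split {c = a} ckb
      -- An upward wall of `a` itself would put `b` and `c` into different regions above `a`.
      ... | inj₁ refl       = ⊥-elim (between⇒¬sameSide bac (rbc wk))
      ... | inj₂ (inj₁ cka) = proj₂ (aboveClear-c k cka) wk
      ... | inj₂ (inj₂ akb) = ⊥-elim (≺-asym k≺b (proj₁ (clear k akb) wk))
    ... | inj₁ ss with sameSide⇒nested (λ { refl → ≺-irrefl refl c≺b }) (λ { refl → ≺-irrefl refl a≺b }) ss
    ...   | inj₂ acb = max c (Below.sees-between (a≺b , clear) acb c≺b) (λ _ → between⇒sameSide acb) a≺c
    ...   | inj₁ abc = higher a≺c c≺b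
      (λ k ckb wk → ≺-trans (proj₁ (aboveClear-c k (between-transˡ (swap abc) ckb)) wk) a≺b)
      (λ k ckb wk _ → proj₂ (aboveClear-c k (between-transˡ (swap abc) ckb)) wk)
      -- A downward wall of `b` would reach down to the height of `a` and hide `c` from it.
      (λ wb → ⊥-elim (≺-asym a≺b (proj₁ (aboveClear-c b (swap abc)) wb)))

adjacent⇒connected : ∀ {m} {R : Rel (Fin m) 0ℓ} →
  (∀ i j → toℕ j ≡ ℕ.suc (toℕ i) → EqClosure R i j) → ∀ x y → EqClosure R x y
adjacent⇒connected {ℕ.zero} _ ()
adjacent⇒connected {ℕ.suc m} {R} adjacent x y = EqC.transitive R (EqC.symmetric R (from0 x)) (from0 y)
  where
  from0 : ∀ y → EqClosure R zero y
  from0 = <-weakInduction (EqClosure R zero) ε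
    (λ i 0~i → EqC.transitive R 0~i (adjacent (inject₁ i) (suc i) (cong ℕ.suc (sym (toℕ-inject₁ i)))))

module Construct {m} (up down : Fin m → Bool) {level : Fin m → Fin m}
                 (level-injective : ∀ {i j} → level i ≡ level j → i ≡ j) where

  private
    _≺_ : Rel (Fin m) 0ℓ
    i ≺ j = level i < level j

    ≺-cmp : Trichotomous _≡_ _≺_
    ≺-cmp i j with <-cmp (level i) (level j)
    ... | tri< i≺j i≢j j⊀i = tri< i≺j (i≢j ∘ cong level) j⊀i
    ... | tri≈ i⊀j i≡j j⊀i = tri≈ i⊀j (level-injective i≡j) j⊀i
    ... | tri> i⊀j i≢j j≺i = tri> i⊀j (i≢j ∘ cong level) j≺i

    sto : IsStrictTotalOrder _≡_ _≺_
    sto = isStrictTotalOrderᶜ record { isEquivalence = isEquivalence ; trans = <-trans ; compare = ≺-cmp }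

  open Sight up down sto using (IsChild; isChild?; child-walls; sees⇒connected)
  module Above = Sight down up (Flip.isStrictTotalOrder sto)

  infix 4 _⟶_ _⟶?_ _⊑_ _⊑?_

  _⟶_ : Rel (Fin m) 0ℓ
  a ⟶ b = IsChild b a

  _⟶?_ : Decidable _⟶_
  a ⟶? b = isChild? b a

  _⊑_ : Rel (Fin m) 0ℓ
  _⊑_ = Star _⟶_

  parent-walls : Walls up _⟶_
  parent-walls = record
    { apart    = λ va vb → apart (parent va) (parent vb)
    ; left     = λ wv va a<v ab → left wv (parent va) a<v (Star.map parent ab)
    ; right    = λ wv va v<a ab → right wv (parent va) v<a (Star.map parent ab)
    ; loopless = λ va → loopless (parent va)
    }
    where
    open Walls Above.child-walls
    parent : ∀ {a b} → IsChild b a → Above.IsChild a b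
    parent = child⇒parent up down sto

  walled : Walled up down level _⟶_
  walled = record { above = parent-walls ; below = child-walls ; rising = λ ab → proj₁ (proj₁ ab) }

  -- Nothing stands between two neighbouring positions, so the higher one sees the lower one.
  connected : ∀ x y → EqClosure _⟶_ x y
  connected = adjacent⇒connected adjacent
    where
    flipped : ∀ {b a} → EqClosure IsChild b a → EqClosure _⟶_ a b
    flipped = reverse λ { (fwd ba) → fwd ba ; (bwd ab) → bwd ab }
    nothing-between : ∀ {i j} → toℕ j ≡ ℕ.suc (toℕ i) → ∀ k → ¬ Between i k j
    nothing-between {i} {j} j≡1+i k (inj₁ (i<k , k<j)) = ℕ.<⇒≱ i<k (ℕ.s≤s⁻¹ (subst (toℕ k ℕ.<_) j≡1+i k<j))
    nothing-between {i} {j} j≡1+i k (inj₂ (j<k , k<i)) =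
      ℕ.<-asym (<-trans {i = j} {k} {i} j<k k<i) (subst (toℕ i ℕ.<_) (sym j≡1+i) (ℕ.n<1+n _))
    adjacent : ∀ i j → toℕ j ≡ ℕ.suc (toℕ i) → EqClosure _⟶_ i j
    adjacent i j j≡1+i with ≺-cmp i j
    ... | tri< i≺j _ _  = flipped (sees⇒connected (i≺j , λ k ikj → ⊥-elim (nothing-between j≡1+i k ikj)))
    ... | tri≈ _ refl _ = ε
    ... | tri> _ _ j≺i  = EqC.symmetric _⟶_
      (flipped (sees⇒connected (j≺i , λ k jki → ⊥-elim (nothing-between j≡1+i k (swap jki)))))

  _⊑?_ : Decidable _⊑_
  x ⊑? y = go (spo-noetherian (IsStrictTotalOrder.isStrictPartialOrder sto) x)
    where
    go : ∀ {x} → Acc (flip _≺_) x → Dec (x ⊑ y)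
    go {x} (acc rs) with x ≟ y
    ... | yes refl = yes ε
    ... | no x≢y   = map′ (λ (c , xc , cy) → xc ◅ cy)
                          (λ { ε → ⊥-elim (x≢y refl) ; (xc ◅ cy) → _ , xc , cy })
                          (any? via?)
      where
      via? : ∀ c → Dec (x ⟶ c × c ⊑ y)
      via? c with x ⟶? c
      ... | no ¬xc = no (¬xc ∘ proj₁)
      ... | yes xc = map′ (xc ,_) proj₂ (go (rs (proj₁ (proj₁ xc))))

-- Permutations, inversions and the weak order

permutation-injective : ∀ {m} (π : Permutation′ m) → Injective _≡_ _≡_ (π ⟨$⟩ʳ_)
permutation-injective π eq = trans (sym (inverseˡ π)) (trans (cong (π ⟨$⟩ˡ_) eq) (inverseˡ π))

injective⇒surjective : ∀ {m} {f : Fin m → Fin m} → Injective _≡_ _≡_ f → ∀ y → ∃ λ x → f x ≡ y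
injective⇒surjective {ℕ.zero} _ ()
injective⇒surjective {ℕ.suc m} {f} inj y with any? (λ x → f x ≟ y)
... | yes hit = hit
... | no miss = ⊥-elim (ℕ.1+n≰n (injective⇒≤ {f = λ x → punchOut (avoid x)}
        (inj ∘ punchOut-injective (avoid _) (avoid _))))
  where
  avoid : ∀ x → y ≢ f x
  avoid x y≡fx = miss (x , sym y≡fx)

injective⇒permutation : ∀ {m} {f : Fin m → Fin m} → Injective _≡_ _≡_ f →
                        ∃ λ (π : Permutation′ m) → ∀ x → π ⟨$⟩ʳ x ≡ f x
injective⇒permutation {f = f} inj = permutation f g (proj₂ ∘ onto) (λ x → inj (proj₂ (onto (f x)))) , λ _ → refl
  where
  onto = injective⇒surjective inj
  g : _
  g y = proj₁ (onto y)

-- Linear orders on positions as permutations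

module Rank {m} {_⊏_ : Rel (Fin m) 0ℓ} (sto : IsStrictTotalOrder _≡_ _⊏_) where
  open IsStrictTotalOrder sto using (compare) renaming (_<?_ to _⊏?_; trans to ⊏-trans; irrefl to ⊏-irrefl)

  predecessors : Fin m → Subset m
  predecessors i = Vec.tabulate λ k → does (k ⊏? i)

  ∈-predecessors⁺ : ∀ {k i} → k ⊏ i → k ∈ predecessors i
  ∈-predecessors⁺ {k} {i} k⊏i =
    lookup⇒[]= k _ (trans (lookup∘tabulate _ k) (dec-true (k ⊏? i) k⊏i))

  ∈-predecessors⁻ : ∀ {k i} → k ∈ predecessors i → k ⊏ i
  ∈-predecessors⁻ {k} {i} k∈ with k ⊏? i | trans (sym (lookup∘tabulate (λ k → does (k ⊏? i)) k)) ([]=⇒lookup k∈)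
  ... | yes k⊏i | _ = k⊏i
  ... | no _ | ()

  self∉predecessors : ∀ {i} → ¬ i ∈ predecessors i
  self∉predecessors = ⊏-irrefl refl ∘ ∈-predecessors⁻

  rank : Fin m → Fin m
  rank i = fromℕ< (subst (∣ predecessors i ∣ ℕ.<_) (∣⊤∣≡n m)
    (p⊂q⇒∣p∣<∣q∣ ((λ _ → ∈⊤) , i , ∈⊤ , self∉predecessors)))

  rank-mono : ∀ {i j} → i ⊏ j → rank i < rank j
  rank-mono {i} {j} i⊏j = subst₂ ℕ._<_ (sym (toℕ-fromℕ< _)) (sym (toℕ-fromℕ< _))
    (p⊂q⇒∣p∣<∣q∣ ((λ k∈ → ∈-predecessors⁺ (⊏-trans (∈-predecessors⁻ k∈) i⊏j))
                 , i , ∈-predecessors⁺ i⊏j , self∉predecessors))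

  rank-injective : Injective _≡_ _≡_ rank
  rank-injective {i} {j} eq with compare i j
  ... | tri< i⊏j _ _ = ⊥-elim (<-irrefl eq (rank-mono i⊏j))
  ... | tri≈ _ i≡j _ = i≡j
  ... | tri> _ _ j⊏i = ⊥-elim (<-irrefl (sym eq) (rank-mono j⊏i))

  ranking : ∃ λ (τ : Permutation′ m) → ∀ {i j} → i ⊏ j → τ ⟨$⟩ʳ i < τ ⟨$⟩ʳ j
  ranking with injective⇒permutation rank-injective
  ... | τ , τ≡rank = τ , λ i⊏j → subst₂ _<_ (sym (τ≡rank _)) (sym (τ≡rank _)) (rank-mono i⊏j)

mono⇒expanding : ∀ {m} {f : Fin m → Fin m} → (∀ {i j} → i < j → f i < f j) → ∀ i → i ≤ f i
mono⇒expanding {ℕ.zero} _ ()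
mono⇒expanding {ℕ.suc m} {f} mono = <-weakInduction (λ i → i ≤ f i) ℕ.z≤n
  (λ i i≤fi → ℕ.≤-trans (ℕ.s≤s (subst (ℕ._≤ toℕ (f (inject₁ i))) (toℕ-inject₁ i) i≤fi))
                        (mono {inject₁ i} {suc i} (ℕ.s≤s (ℕ.≤-reflexive (toℕ-inject₁ i)))))

-- `τ σ⁻¹` is strictly increasing, so it moves no point down; the same holds for its inverse.
order-determines : ∀ {m} {σ τ : Permutation′ m} →
  (∀ {i j} → σ ⟨$⟩ʳ i < σ ⟨$⟩ʳ j → τ ⟨$⟩ʳ i < τ ⟨$⟩ʳ j) → σ ≈ τ
order-determines {m} {σ} {τ} σ⇒τ i = ≤-antisym (below {σ} {τ} σ⇒τ i) (below {τ} {σ} τ⇒σ i)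
  where
  below : ∀ {σ τ : Permutation′ m} → (∀ {i j} → σ ⟨$⟩ʳ i < σ ⟨$⟩ʳ j → τ ⟨$⟩ʳ i < τ ⟨$⟩ʳ j) →
          ∀ i → σ ⟨$⟩ʳ i ≤ τ ⟨$⟩ʳ i
  below {σ} {τ} σ⇒τ i = subst (λ k → σ ⟨$⟩ʳ i ≤ τ ⟨$⟩ʳ k) (inverseˡ σ)
    (mono⇒expanding {f = λ k → τ ⟨$⟩ʳ (σ ⟨$⟩ˡ k)}
      (λ a<b → σ⇒τ (subst₂ _<_ (sym (inverseʳ σ)) (sym (inverseʳ σ)) a<b)) (σ ⟨$⟩ʳ i))
  τ⇒σ : ∀ {i j} → τ ⟨$⟩ʳ i < τ ⟨$⟩ʳ j → σ ⟨$⟩ʳ i < σ ⟨$⟩ʳ j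
  τ⇒σ {i} {j} τi<τj with <-cmp (σ ⟨$⟩ʳ i) (σ ⟨$⟩ʳ j)
  ... | tri< σi<σj _ _ = σi<σj
  ... | tri≈ _ σi≡σj _ = ⊥-elim (<-irrefl (cong (τ ⟨$⟩ʳ_) (permutation-injective σ σi≡σj)) τi<τj)
  ... | tri> _ _ σj<σi = ⊥-elim (<-asym τi<τj (σ⇒τ σj<σi))

-- Counting inversions

𝟙 : ∀ {a} {A : Set a} → Dec A → ℕ
𝟙 a? = if does a? then 1 else 0

𝟙-⊎ : ∀ {a b c} {A : Set a} {B : Set b} {C : Set c} (a? : Dec A) (b? : Dec B) (c? : Dec C) →
      (A → C) → (B → C) → (C → A ⊎ B) → (A → ¬ B) → 𝟙 a? + 𝟙 b? ≡ 𝟙 c?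
𝟙-⊎ (yes a) (yes b) _       _ _ _ disjoint = ⊥-elim (disjoint a b)
𝟙-⊎ (yes a) (no _)  (yes _) _ _ _ _        = refl
𝟙-⊎ (yes a) (no _)  (no ¬c) a⇒c _ _ _      = ⊥-elim (¬c (a⇒c a))
𝟙-⊎ (no _)  (yes b) (yes _) _ _ _ _        = refl
𝟙-⊎ (no _)  (yes b) (no ¬c) _ b⇒c _ _      = ⊥-elim (¬c (b⇒c b))
𝟙-⊎ (no _)  (no _)  (no _)  _ _ _ _        = refl
𝟙-⊎ (no ¬a) (no ¬b) (yes c) _ _ split _ with split c
... | inj₁ a = ⊥-elim (¬a a)
... | inj₂ b = ⊥-elim (¬b b)

module _ {A : Set} {P : Pred A 0ℓ} (P? : Unary.Decidable P) where

  length-filter-tabulate : ∀ {m} (f : Fin m → A) →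
    length (filter P? (List.tabulate f)) ≡ sum (λ i → 𝟙 (P? (f i)))
  length-filter-tabulate {ℕ.zero}  f = refl
  length-filter-tabulate {ℕ.suc m} f with P? (f zero)
  ... | yes _ = cong ℕ.suc (length-filter-tabulate (f ∘ suc))
  ... | no _  = length-filter-tabulate (f ∘ suc)

length-filter-product : ∀ {m k} {A : Set} {P : Pred (A × Fin k) 0ℓ} (P? : Unary.Decidable P) (f : Fin m → A) →
  length (filter P? (cartesianProduct (List.tabulate f) (allFin k))) ≡
  sum (λ i → sum (λ j → 𝟙 (P? (f i , j))))
length-filter-product {ℕ.zero}  P? f = refl
length-filter-product {ℕ.suc m} {k} P? f = begin
  length (filter P? (row ++ rest))
    ≡⟨ cong length (filter-++ P? row rest) ⟩
  length (filter P? row ++ filter P? rest)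
    ≡⟨ length-++ (filter P? row) ⟩
  length (filter P? row) + length (filter P? rest)
    ≡⟨ cong₂ _+_ (cong (length ∘ filter P?) (map-tabulate {n = k} id (f zero ,_))) (length-filter-product P? (f ∘ suc)) ⟩
  length (filter P? (List.tabulate (f zero ,_))) + sum (λ i → sum (λ j → 𝟙 (P? (f (suc i) , j))))
    ≡⟨ cong (_+ _) (length-filter-tabulate P? (f zero ,_)) ⟩
  sum (λ i → sum (λ j → 𝟙 (P? (f i , j)))) ∎
  where
  open ≡-Reasoning
  row  = List.map (f zero ,_) (allFin k)
  rest = cartesianProduct (List.tabulate (f ∘ suc)) (allFin k)

Inversion : ∀ {m} → Permutation′ m → Fin m → Fin m → Set
Inversion w i j = i < j × w ⟨$⟩ʳ j < w ⟨$⟩ʳ i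

inversion? : ∀ {m} (w : Permutation′ m) i j → Dec (Inversion w i j)
inversion? w i j = i <? j ×-dec w ⟨$⟩ʳ j <? w ⟨$⟩ʳ i

-- A double sum can be reindexed by a permutation of the positions.
ℓ≡sum : ∀ {m} (w : Permutation′ m) → ℓ w ≡ sum (λ i → sum (λ j → 𝟙 (inversion? w i j)))
ℓ≡sum w = length-filter-product (λ (i , j) → inversion? w i j) id

-- Relabelling positions along x turns the inversions of y x⁻¹ into the pairs
-- inverted by y but not by x.
inversions⊆⇒≤L : ∀ {m} (x y : Permutation′ m) → (∀ {i j} → Inversion x i j → Inversion y i j) → x ≤L y
inversions⊆⇒≤L {m} x y x⊆y = begin
  ℓ yx⁻¹ + ℓ x
    ≡⟨ cong₂ _+_ (ℓ≡sum yx⁻¹) (ℓ≡sum x) ⟩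
  sum (λ i → sum (λ j → 𝟙 (inversion? yx⁻¹ i j))) + inversions x
    ≡⟨ cong (_+ inversions x) (trans (sum-permute _ x) (sum-cong-≗ λ i → sum-permute (λ j → 𝟙 (inversion? yx⁻¹ (x ⟨$⟩ʳ i) j)) x)) ⟩
  sum (λ i → sum (λ j → 𝟙 (A? i j))) + inversions x
    ≡⟨ sym (∑-distrib-+ _ (λ i → sum (λ j → 𝟙 (inversion? x i j)))) ⟩
  sum (λ i → sum (λ j → 𝟙 (A? i j)) + sum (λ j → 𝟙 (inversion? x i j)))
    ≡⟨ sum-cong-≗ (λ i → sym (∑-distrib-+ (λ j → 𝟙 (A? i j)) (λ j → 𝟙 (inversion? x i j)))) ⟩
  sum (λ i → sum (λ j → 𝟙 (A? i j) + 𝟙 (inversion? x i j)))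
    ≡⟨ sum-cong-≗ (λ i → sum-cong-≗ (λ j → 𝟙-⊎ (A? i j) (inversion? x i j) (inversion? y i j) A⇒y x⊆y y⇒A⊎x disjoint)) ⟩
  inversions y
    ≡⟨ sym (ℓ≡sum y) ⟩
  ℓ y ∎
  where
  open ≡-Reasoning
  yx⁻¹ = y ↔-∘ ↔-sym x
  inversions : Permutation′ m → ℕ
  inversions w = sum (λ i → sum (λ j → 𝟙 (inversion? w i j)))
  A? : ∀ i j → Dec (Inversion yx⁻¹ (x ⟨$⟩ʳ i) (x ⟨$⟩ʳ j))
  A? i j = inversion? yx⁻¹ (x ⟨$⟩ʳ i) (x ⟨$⟩ʳ j)
  back : ∀ i → yx⁻¹ ⟨$⟩ʳ (x ⟨$⟩ʳ i) ≡ y ⟨$⟩ʳ i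
  back i = cong (y ⟨$⟩ʳ_) (inverseˡ x)
  A⇒y : ∀ {i j} → Inversion yx⁻¹ (x ⟨$⟩ʳ i) (x ⟨$⟩ʳ j) → Inversion y i j
  A⇒y {i} {j} (xi<xj , inv) with subst₂ _<_ (back j) (back i) inv | <-cmp i j
  ... | yj<yi | tri< i<j _ _  = i<j , yj<yi
  ... | yj<yi | tri≈ _ refl _ = ⊥-elim (<-irrefl refl xi<xj)
  -- Here `x` inverts the pair `(j , i)`, hence so does `y`, against `yj<yi`.
  ... | yj<yi | tri> _ _ j<i  = ⊥-elim (<-asym yj<yi (proj₂ (x⊆y (j<i , xi<xj))))
  y⇒A⊎x : ∀ {i j} → Inversion y i j → Inversion yx⁻¹ (x ⟨$⟩ʳ i) (x ⟨$⟩ʳ j) ⊎ Inversion x i j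
  y⇒A⊎x {i} {j} (i<j , yj<yi) with <-cmp (x ⟨$⟩ʳ i) (x ⟨$⟩ʳ j)
  ... | tri< xi<xj _ _ = inj₁ (xi<xj , subst₂ _<_ (sym (back j)) (sym (back i)) yj<yi)
  ... | tri≈ _ xi≡xj _ = ⊥-elim (<-irrefl (permutation-injective x xi≡xj) i<j)
  ... | tri> _ _ xj<xi = inj₂ (i<j , xj<xi)
  disjoint : ∀ {i j} → Inversion yx⁻¹ (x ⟨$⟩ʳ i) (x ⟨$⟩ʳ j) → ¬ Inversion x i j
  disjoint (xi<xj , _) (_ , xj<xi) = <-asym xi<xj xj<xi

ℓ≡0⇒mono : ∀ {m} (w : Permutation′ m) → ℓ w ≡ 0 → ∀ {i j} → i < j → w ⟨$⟩ʳ i < w ⟨$⟩ʳ j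
ℓ≡0⇒mono {m} w ℓ≡0 {i} {j} i<j with <-cmp (w ⟨$⟩ʳ i) (w ⟨$⟩ʳ j)
... | tri< wi<wj _ _ = wi<wj
... | tri≈ _ wi≡wj _ = ⊥-elim (<-irrefl (permutation-injective w wi≡wj) i<j)
... | tri> _ _ wj<wi = ⊥-elim (empty ℓ≡0
  (∈-filter⁺ (λ (i , j) → inversion? w i j) (∈-cartesianProduct⁺ (∈-allFin i) (∈-allFin j)) (i<j , wj<wi)))
  where
  empty : ∀ {A : Set} {x : A} {xs : List A} → length xs ≡ 0 → ¬ x List∈.∈ xs
  empty () (here _)
  empty () (there _)

-- Adding the two length equations gives `ℓ yx⁻¹ ≡ 0`, so `y x⁻¹` is increasing and `x` and `y`
-- induce the same order.
≤L-antisym : ∀ {m} (x y : Permutation′ m) → x ≤L y → y ≤L x → x ≈ y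
≤L-antisym x y x≤y y≤x = order-determines {σ = x} {y} λ xi<xj →
  subst₂ _<_ (cong (y ⟨$⟩ʳ_) (inverseˡ x)) (cong (y ⟨$⟩ʳ_) (inverseˡ x)) (ℓ≡0⇒mono yx⁻¹ ℓ≡0 xi<xj)
  where
  open ≡-Reasoning
  yx⁻¹ = y ↔-∘ ↔-sym x
  xy⁻¹ = x ↔-∘ ↔-sym y
  ℓ≡0 : ℓ yx⁻¹ ≡ 0
  ℓ≡0 = ℕ.m+n≡0⇒n≡0 (ℓ xy⁻¹) (ℕ.+-cancelʳ-≡ (ℓ x) _ 0 (begin
    (ℓ xy⁻¹ + ℓ yx⁻¹) + ℓ x ≡⟨ ℕ.+-assoc (ℓ xy⁻¹) _ _ ⟩
    ℓ xy⁻¹ + (ℓ yx⁻¹ + ℓ x) ≡⟨ cong (ℓ xy⁻¹ +_) x≤y ⟩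
    ℓ xy⁻¹ + ℓ y             ≡⟨ y≤x ⟩
    ℓ x                       ∎))

-- Postorders

-- The postorder condition read on labels, where postorders of trees with different vertex types can
-- be compared.
record IsPost {m} (_⊑_ : Rel (Fin m) 0ℓ) (τ : Permutation′ m) : Set where
  field
    extends     : ∀ {i j} → i ⊑ j → τ ⟨$⟩ʳ i ≤ τ ⟨$⟩ʳ j
    leftToRight : ∀ {i j} → ¬ i ⊑ j → ¬ j ⊑ i → i < j → τ ⟨$⟩ʳ i < τ ⟨$⟩ʳ j

-- A pair on which `σ` and `τ` disagree is incomparable, since both extend the order; but then both
-- follow the labels.
post-unique : ∀ {m} {_⊑_ _⊑′_ : Rel (Fin m) 0ℓ} {σ τ : Permutation′ m} →
  (∀ {i j} → i ⊑ j → i ⊑′ j) → (∀ {i j} → i ⊑′ j → i ⊑ j) →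
  IsPost _⊑_ σ → IsPost _⊑′_ τ → σ ≈ τ
post-unique {_⊑_ = _⊑_} {_} {σ} {τ} ⊑⇒⊑′ ⊑′⇒⊑ S T = order-determines {σ = σ} {τ} σ⇒τ
  where
  module S = IsPost S
  module T = IsPost T
  σ⇒τ : ∀ {i j} → σ ⟨$⟩ʳ i < σ ⟨$⟩ʳ j → τ ⟨$⟩ʳ i < τ ⟨$⟩ʳ j
  σ⇒τ {i} {j} σi<σj with <-cmp (τ ⟨$⟩ʳ i) (τ ⟨$⟩ʳ j)
  ... | tri< τi<τj _ _ = τi<τj
  ... | tri≈ _ τi≡τj _ = ⊥-elim (<-irrefl (cong (σ ⟨$⟩ʳ_) (permutation-injective τ τi≡τj)) σi<σj)
  ... | tri> _ _ τj<τi
    = ⊥-elim (impossible (<-cmp i j))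
    where
    i⋢j : ¬ i ⊑ j
    i⋢j i⊑j = ℕ.<⇒≱ τj<τi (T.extends (⊑⇒⊑′ i⊑j))
    j⋢i : ¬ j ⊑ i
    j⋢i j⊑i = ℕ.<⇒≱ σi<σj (S.extends j⊑i)
    impossible : ¬ Tri (i < j) (i ≡ j) (j < i)
    impossible (tri< i<j _ _)  = <-asym τj<τi (T.leftToRight (i⋢j ∘ ⊑′⇒⊑) (j⋢i ∘ ⊑′⇒⊑) i<j)
    impossible (tri≈ _ refl _) = <-irrefl refl σi<σj
    impossible (tri> _ _ j<i)  = <-asym σi<σj (S.leftToRight j⋢i i⋢j j<i)

-- A postorder puts incomparable pairs in label order, so it inverts `i < j` only when `j ⊑ i`, and
-- then every extension of the order inverts the pair as well.
post-≤L : ∀ {m} {_⊑_ : Rel (Fin m) 0ℓ} {τ v : Permutation′ m} → IsPost _⊑_ τ →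
          (∀ {i j} → i ⊑ j → v ⟨$⟩ʳ i ≤ v ⟨$⟩ʳ j) → τ ≤L v
post-≤L {_⊑_ = _⊑_} {τ} {v} post v-extends = inversions⊆⇒≤L τ v inverted
  where
  open IsPost post
  inverted : ∀ {i j} → Inversion τ i j → Inversion v i j
  inverted {i} {j} (i<j , τj<τi) with <-cmp (v ⟨$⟩ʳ i) (v ⟨$⟩ʳ j)
  ... | tri> _ _ vj<vi = i<j , vj<vi
  ... | tri≈ _ vi≡vj _ = ⊥-elim (<-irrefl (permutation-injective v vi≡vj) i<j)
  ... | tri< vi<vj _ _ = ⊥-elim (<-asym τj<τi (leftToRight i⋢j j⋢i i<j))
    where
    i⋢j : ¬ i ⊑ j
    i⋢j i⊑j = ℕ.<⇒≱ τj<τi (extends i⊑j)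
    j⋢i : ¬ j ⊑ i
    j⋢i j⊑i = ℕ.<⇒≱ vi<vj (v-extends j⊑i)

module PostExists {m} {up down : Fin m → Bool} {level : Fin m → Fin m} {_⟶_ : Rel (Fin m) 0ℓ}
  (W : Walled up down level _⟶_) (connected : ∀ x y → EqClosure _⟶_ x y) (_⊑?_ : Decidable (Star _⟶_)) where
  open Walled W
  open Connected connected

  private
    _⊑_ : Rel (Fin m) 0ℓ
    _⊑_ = Star _⟶_

  _⊏_ : Rel (Fin m) 0ℓ
  i ⊏ j = (i ⊑ j × i ≢ j) ⊎ (¬ i ⊑ j × ¬ j ⊑ i × i < j)

  ⊑-antisym : ∀ {i j} → i ⊑ j → j ⊑ i → i ≡ j
  ⊑-antisym ε _ = refl
  ⊑-antisym (ic ◅ cj) ji = ⊥-elim (ℕ.<⇒≱ (rising ic) (rising* (cj ◅◅ ji)))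

  -- The case where the walls enter: `k` lies between `j` and `i`, so `comparable-between` makes it
  -- comparable with one of them.
  no-cycle₁ : ∀ {i j k} → i ⊑ j → ¬ j ⊑ k → ¬ k ⊑ j → j < k → ¬ k ⊑ i → ¬ i ⊑ k → ¬ k < i
  no-cycle₁ ij j⋢k k⋢j j<k k⋢i i⋢k k<i with comparable-between ij (inj₂ (j<k , k<i))
  ... | inj₁ kj = k⋢j kj
  ... | inj₂ ik = i⋢k ik

  no-cycle₂ : ∀ {i j k} → i ⊑ j → i ≢ j → j ⊑ k → ¬ k ⊏ i
  no-cycle₂ ij i≢j jk (inj₁ (ki , _))        = i≢j (⊑-antisym ij (jk ◅◅ ki))
  no-cycle₂ ij _   jk (inj₂ (_ , i⋢k , _)) = i⋢k (ij ◅◅ jk)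

  -- For a total asymmetric relation, excluding cycles of length three amounts to transitivity. The
  -- cases go by the number of incomparable pairs: at most one is `no-cycle₂`, two is `no-cycle₁`,
  -- and three would be a cycle of labels.
  no-cycle : ∀ {i j k} → i ⊏ j → j ⊏ k → ¬ k ⊏ i
  no-cycle (inj₁ (ij , i≢j)) (inj₁ (jk , _)) ki = no-cycle₂ ij i≢j jk ki
  no-cycle (inj₁ (ij , _)) jk@(inj₂ _) (inj₁ (ki , k≢i)) = no-cycle₂ ki k≢i ij jk
  no-cycle ij@(inj₂ _) (inj₁ (jk , j≢k)) (inj₁ (ki , _)) = no-cycle₂ jk j≢k ki ij
  no-cycle (inj₁ (ij , _)) (inj₂ (j⋢k , k⋢j , j<k)) (inj₂ (k⋢i , i⋢k , k<i)) =
    no-cycle₁ ij j⋢k k⋢j j<k k⋢i i⋢k k<i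
  no-cycle (inj₂ (i⋢j , j⋢i , i<j)) (inj₁ (jk , _)) (inj₂ (k⋢i , i⋢k , k<i)) =
    no-cycle₁ jk k⋢i i⋢k k<i i⋢j j⋢i i<j
  no-cycle (inj₂ (i⋢j , j⋢i , i<j)) (inj₂ (j⋢k , k⋢j , j<k)) (inj₁ (ki , _)) =
    no-cycle₁ ki i⋢j j⋢i i<j j⋢k k⋢j j<k
  no-cycle (inj₂ (_ , _ , i<j)) (inj₂ (_ , _ , j<k)) (inj₂ (_ , _ , k<i)) =
    <-asym (<-trans i<j j<k) k<i

  ⊏-irrefl : ∀ {i} → ¬ i ⊏ i
  ⊏-irrefl (inj₁ (_ , i≢i))     = i≢i refl
  ⊏-irrefl (inj₂ (i⋢i , _ , _)) = i⋢i ε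

  ⊏-asym : ∀ {i j} → i ⊏ j → ¬ j ⊏ i
  ⊏-asym (inj₁ (ij , i≢j)) (inj₁ (ji , _))          = i≢j (⊑-antisym ij ji)
  ⊏-asym (inj₁ (ij , _))   (inj₂ (_ , i⋢j , _))     = i⋢j ij
  ⊏-asym (inj₂ (_ , j⋢i , _)) (inj₁ (ji , _))       = j⋢i ji
  ⊏-asym (inj₂ (_ , _ , i<j)) (inj₂ (_ , _ , j<i)) = <-asym i<j j<i

  ⊏-total : ∀ i j → i ⊏ j ⊎ i ≡ j ⊎ j ⊏ i
  ⊏-total i j with i ≟ j | i ⊑? j | j ⊑? i
  ... | yes i≡j | _      | _      = inj₂ (inj₁ i≡j)
  ... | no i≢j  | yes ij | _      = inj₁ (inj₁ (ij , i≢j))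
  ... | no i≢j  | no _   | yes ji = inj₂ (inj₂ (inj₁ (ji , i≢j ∘ sym)))
  ... | no i≢j  | no i⋢j | no j⋢i with <-cmp i j
  ...   | tri< i<j _ _ = inj₁ (inj₂ (i⋢j , j⋢i , i<j))
  ...   | tri≈ _ i≡j _ = inj₂ (inj₁ i≡j)
  ...   | tri> _ _ j<i = inj₂ (inj₂ (inj₂ (j⋢i , i⋢j , j<i)))

  ⊏-cmp : Trichotomous _≡_ _⊏_
  ⊏-cmp i j with ⊏-total i j
  ... | inj₁ i⊏j         = tri< i⊏j (λ { refl → ⊏-irrefl i⊏j }) (⊏-asym i⊏j)
  ... | inj₂ (inj₁ refl) = tri≈ ⊏-irrefl refl ⊏-irrefl
  ... | inj₂ (inj₂ j⊏i)  = tri> (⊏-asym j⊏i) (λ { refl → ⊏-irrefl j⊏i }) j⊏i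

  ⊏-trans : ∀ {i j k} → i ⊏ j → j ⊏ k → i ⊏ k
  ⊏-trans {i} {_} {k} ij jk with ⊏-total i k
  ... | inj₁ ik          = ik
  ... | inj₂ (inj₁ refl) = ⊥-elim (⊏-asym ij jk)
  ... | inj₂ (inj₂ ki)   = ⊥-elim (no-cycle ij jk ki)

  postorder : ∃ λ τ → IsPost _⊑_ τ
  postorder with Rank.ranking (isStrictTotalOrderᶜ record { isEquivalence = isEquivalence ; trans = ⊏-trans ; compare = ⊏-cmp })
  ... | τ , mono = τ , record { extends = extends ; leftToRight = λ i⋢j j⋢i i<j → mono (inj₂ (i⋢j , j⋢i , i<j)) }
    where
    extends : ∀ {i j} → i ⊑ j → τ ⟨$⟩ʳ i ≤ τ ⟨$⟩ʳ j
    extends {i} {j} ij with i ≟ j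
    ... | yes refl = ≤-refl
    ... | no i≢j   = ℕ.<⇒≤ (mono (inj₁ (ij , i≢j)))

-- Permutrees

up down : ∀ {m} → Vec Decoration m → Fin m → Bool
up   δ i = hasUp (lookup δ i)
down δ i = hasDown (lookup δ i)

module _ {A : Set} {R : Rel A 0ℓ} where

  ◅⇒⁺ : ∀ {a b c} → R a b → Star R b c → TransClosure R a c
  ◅⇒⁺ ab ε         = [ ab ]
  ◅⇒⁺ ab (bc ◅ cs) = ab ∷ ◅⇒⁺ bc cs

  ⁺⇒* : ∀ {a b} → TransClosure R a b → Star R a b
  ⁺⇒* [ ab ]    = ab ◅ ε
  ⁺⇒* (ab ∷ bc) = ab ◅ ⁺⇒* bc

  *⇒≡⊎⁺ : ∀ {a b} → Star R a b → a ≡ b ⊎ TransClosure R a b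
  *⇒≡⊎⁺ ε         = inj₁ refl
  *⇒≡⊎⁺ (ac ◅ cb) = inj₂ (◅⇒⁺ ac cb)

-- Transport of vertex relations to labels

module Labelled {m} {V : Set} (p : V ↔ Fin m) where

  relabel : Rel V 0ℓ → Rel (Fin m) 0ℓ
  relabel R i j = R (from p i) (from p j)

  relabel-* : ∀ {R i j} → Star R (from p i) (from p j) → Star (relabel R) i j
  relabel-* {R} {i} {j} path = subst₂ (Star (relabel R)) (strictlyInverseˡ p i) (strictlyInverseˡ p j)
    (Star.gmap (to p) (subst₂ R (sym (strictlyInverseʳ p _)) (sym (strictlyInverseʳ p _))) path)

  relabel-connected : ∀ {R} → (∀ x y → EqClosure R x y) → ∀ i j → EqClosure (relabel R) i j
  relabel-connected {R} connected i j =
    subst₂ (EqClosure (relabel R)) (strictlyInverseˡ p i) (strictlyInverseˡ p j)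
      (EqC.gmap (to p) (subst₂ R (sym (strictlyInverseʳ p _)) (sym (strictlyInverseʳ p _)))
        (connected (from p i) (from p j)))

  _◁_ : Rel V 0ℓ
  x ◁ y = to p x < to p y

  relabel-< : ∀ {i j} → i < j → from p i ◁ from p j
  relabel-< = subst₂ _<_ (sym (strictlyInverseˡ p _)) (sym (strictlyInverseˡ p _))

  unlabel-< : ∀ {i j} → from p i ◁ from p j → i < j
  unlabel-< = subst₂ _<_ (strictlyInverseˡ p _) (strictlyInverseˡ p _)

  -- The hypotheses are the shape shared by the parent and the child conditions of a permutree, so
  -- that both become instances of `Walls`.
  relabel-walls : ∀ {R : Rel V 0ℓ} (g : Fin m → Bool) →
    (∀ {v a b} → g (to p v) ≡ false → R v a → R v b → a ≡ b) →
    (∀ {v a b} → g (to p v) ≡ true → R v a → a ◁ v → R v b → b ◁ v → a ≡ b) →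
    (∀ {v a b} → g (to p v) ≡ true → R v a → v ◁ a → R v b → v ◁ b → a ≡ b) →
    (∀ {v a b} → g (to p v) ≡ true → R v a → a ◁ v → Star R a b → b ◁ v) →
    (∀ {v a b} → g (to p v) ≡ true → R v a → v ◁ a → Star R a b → v ◁ b) →
    (∀ {v a} → R v a → a ≢ v) →
    Walls g (relabel R)
  relabel-walls {R} g one oneLeft oneRight allLeft allRight loopless = record
    { apart    = apart
    ; left     = λ gv va a<v ab → unlabel-< (allLeft (wall gv) va (relabel-< a<v) (Star.gmap (from p) id ab))
    ; right    = λ gv va v<a ab → unlabel-< (allRight (wall gv) va (relabel-< v<a) (Star.gmap (from p) id ab))
    ; loopless = λ va a≡v → loopless va (cong (from p) a≡v)
    }
    where
    wall : ∀ {i β} → g i ≡ β → g (to p (from p i)) ≡ β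
    wall gi = trans (cong g (strictlyInverseˡ p _)) gi
    from-injective : ∀ {i j} → from p i ≡ from p j → i ≡ j
    from-injective eq = trans (sym (strictlyInverseˡ p _)) (trans (cong (to p) eq) (strictlyInverseˡ p _))
    apart : ∀ {v a b} → relabel R v a → relabel R v b → a ≢ b → g v ≡ true × Between a v b
    apart {v} {a} {b} va vb a≢b with g v in gv | <-cmp a v | <-cmp b v
    ... | false | _ | _ = ⊥-elim (a≢b (from-injective (one (wall gv) va vb)))
    ... | true | tri≈ _ a≡v _ | _ = ⊥-elim (loopless va (cong (from p) a≡v))
    ... | true | tri< _ _ _ | tri≈ _ b≡v _ = ⊥-elim (loopless vb (cong (from p) b≡v))
    ... | true | tri> _ _ _ | tri≈ _ b≡v _ = ⊥-elim (loopless vb (cong (from p) b≡v))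
    ... | true | tri< a<v _ _ | tri> _ _ v<b = refl , inj₁ (a<v , v<b)
    ... | true | tri> _ _ v<a | tri< b<v _ _ = refl , inj₂ (b<v , v<a)
    ... | true | tri< a<v _ _ | tri< b<v _ _ =
      ⊥-elim (a≢b (from-injective (oneLeft (wall gv) va (relabel-< a<v) vb (relabel-< b<v))))
    ... | true | tri> _ _ v<a | tri> _ _ v<b =
      ⊥-elim (a≢b (from-injective (oneRight (wall gv) va (relabel-< v<a) vb (relabel-< v<b))))

open DecreasingPermutree using () renaming (tree to tree-of)

module Order {m} {δ : Vec Decoration m} (T : Permutree δ) where
  open Permutree T
  open Labelled p public using (relabel-*)
  open Labelled p using (relabel; relabel-walls; relabel-connected)
  open IsDirectedTree isTree

  infix 4 _⟶ˡ_ _⊑_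

  _⟶ˡ_ : Rel (Fin m) 0ℓ
  _⟶ˡ_ = relabel _⟶_

  _⊑_ : Rel (Fin m) 0ℓ
  _⊑_ = Star _⟶ˡ_

  ⊑⇒⪯ : ∀ {i j} → i ⊑ j → from p i ⪯ from p j
  ⊑⇒⪯ = Star.gmap (from p) id

  loopless : ∀ {x y} → x ⟶ y → x ≢ y
  loopless x⟶x refl = asymmetric x⟶x x⟶x

  label-connected : ∀ i j → EqClosure _⟶ˡ_ i j
  label-connected = relabel-connected connected

  parent-walls : Walls (up δ) _⟶ˡ_
  parent-walls = relabel-walls (up δ) oneParent oneLeftParent oneRightParent
    (λ wv va a◁v ab → [ (λ { refl → a◁v }) , leftAncestors wv va a◁v ]′ (*⇒≡⊎⁺ ab))
    (λ wv va v◁a ab → [ (λ { refl → v◁a }) , rightAncestors wv va v◁a ]′ (*⇒≡⊎⁺ ab))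
    (λ va → loopless va ∘ sym)

  child-walls : Walls (down δ) (flip _⟶ˡ_)
  child-walls = relabel-walls (down δ) oneChild oneLeftChild oneRightChild
    (λ wv av a◁v ba → [ (λ { refl → a◁v }) , leftDescendants wv av a◁v ]′ (*⇒≡⊎⁺ (reverse id ba)))
    (λ wv av v◁a ba → [ (λ { refl → v◁a }) , rightDescendants wv av v◁a ]′ (*⇒≡⊎⁺ (reverse id ba)))
    loopless

  post : ∀ {τ} → IsPostorder τ → IsPost _⊑_ (τ ↔-∘ ↔-sym p)
  post (linear , leftToRight) = record
    { extends     = linear ∘ ⊑⇒⪯
    ; leftToRight = λ i⋢j j⋢i i<j → leftToRight (i⋢j ∘ relabel-*) (j⋢i ∘ relabel-*) (Labelled.relabel-< p i<j)
    }

-- At the label of a vertex, `w` takes the value of `σ`, which rises along arrows, strictly because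
-- an arrow joins distinct vertices.
walled : ∀ {m} {δ : Vec Decoration m} (w : Permutation′ m) (𝒯 : DecreasingPermutree δ) → 𝓘⁻¹ δ w 𝒯 →
         Walled (up δ) (down δ) (w ⟨$⟩ʳ_) (Order._⟶ˡ_ (tree-of 𝒯))
walled w 𝒯 𝓘𝒯≈w = record
  { above  = parent-walls
  ; below  = child-walls
  ; rising = λ ij → subst₂ _<_ (𝓘𝒯≈w _) (𝓘𝒯≈w _)
      (ℕ.≤∧≢⇒< (σ-linear (ij ◅ ε)) (λ eq → loopless ij (σ-injective (toℕ-injective eq))))
  }
  where
  open DecreasingPermutree 𝒯
  open Order tree
  σ-injective : ∀ {x y} → to σ x ≡ to σ y → x ≡ y
  σ-injective eq = trans (sym (strictlyInverseʳ σ _)) (trans (cong (from σ) eq) (strictlyInverseʳ σ _))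

≅-refl : ∀ {m} {δ : Vec Decoration m} {T : Permutree δ} → T ≅ T
≅-refl = ↔-id _ , (λ _ → refl) , (λ _ _ → mk⇔ id id)

≅⇒arrow : ∀ {m} {δ : Vec Decoration m} (T T′ : Permutree δ) → T ≅ T′ → ∀ i j →
          Order._⟶ˡ_ T i j ⇔ Order._⟶ˡ_ T′ i j
≅⇒arrow T T′ (φ , label , arrow) i j =
  subst₂ (λ x y → (from T.p i T.⟶ from T.p j) ⇔ (x T′.⟶ y)) (φ-from i) (φ-from j) (arrow _ _)
  where
  module T = Permutree T
  module T′ = Permutree T′
  φ-from : ∀ k → to φ (from T.p k) ≡ from T′.p k
  φ-from k = trans (sym (strictlyInverseʳ T′.p _))
                   (cong (from T′.p) (trans (label _) (strictlyInverseˡ T.p k)))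

-- The class of a permutation, its least element, and the two operators

module Canonical {m} (δ : Vec Decoration m) (w : Permutation′ m) where
  open Construct (up δ) (down δ) (permutation-injective w)
    using (_⟶_; _⟶?_; _⊑_; _⊑?_; connected) renaming (walled to canonical-walled)
  open Walled canonical-walled using (above; below; rising; rising*; acyclic)
  private
    module Parents = Walls above
    module Children = Walls below

  one : ∀ {wall : Fin m → Bool} {R v a b} → Walls {m} wall R → wall v ≡ false → R v a → R v b → a ≡ b
  one {v = v} {a} {b} W wv va vb with a ≟ b
  ... | yes a≡b = a≡b
  ... | no a≢b with trans (sym wv) (proj₁ (Walls.apart W va vb a≢b))
  ...   | ()

  oneLeft : ∀ {wall : Fin m → Bool} {R v a b} → Walls {m} wall R → R v a → a < v → R v b → b < v → a ≡ b
  oneLeft {v = v} {a} {b} W va a<v vb b<v with a ≟ b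
  ... | yes a≡b = a≡b
  ... | no a≢b with proj₂ (Walls.apart W va vb a≢b)
  ...   | inj₁ (_ , v<b) = ⊥-elim (<-asym b<v v<b)
  ...   | inj₂ (_ , v<a) = ⊥-elim (<-asym a<v v<a)

  oneRight : ∀ {wall : Fin m → Bool} {R v a b} → Walls {m} wall R → R v a → v < a → R v b → v < b → a ≡ b
  oneRight {v = v} {a} {b} W va v<a vb v<b with a ≟ b
  ... | yes a≡b = a≡b
  ... | no a≢b with proj₂ (Walls.apart W va vb a≢b)
  ...   | inj₁ (a<v , _) = ⊥-elim (<-asym a<v v<a)
  ...   | inj₂ (b<v , _) = ⊥-elim (<-asym b<v v<b)

  tree : Permutree δ
  tree = record
    { V                = Fin m
    ; _⟶_              = _⟶_
    ; _⟶?_             = _⟶?_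
    ; isTree           = record
      { asymmetric = λ ab ba → <-asym (rising ab) (rising ba)
      ; connected  = connected
      ; acyclic    = acyclic
      }
    ; p                = ↔-id _
    ; oneParent        = one above
    ; oneLeftParent    = λ _ → oneLeft above
    ; oneRightParent   = λ _ → oneRight above
    ; leftAncestors    = λ wv va a<v ab → Parents.left wv va a<v (⁺⇒* ab)
    ; rightAncestors   = λ wv va v<a ab → Parents.right wv va v<a (⁺⇒* ab)
    ; oneChild         = one below
    ; oneLeftChild     = λ _ → oneLeft below
    ; oneRightChild    = λ _ → oneRight below
    ; leftDescendants  = λ wv av a<v ba → Children.left wv av a<v (reverse id (⁺⇒* ba))
    ; rightDescendants = λ wv av v<a ba → Children.right wv av v<a (reverse id (⁺⇒* ba))
    }

  decreasing : (σ : Permutation′ m) → (∀ {i j} → i ⊑ j → σ ⟨$⟩ʳ i ≤ σ ⟨$⟩ʳ j) → DecreasingPermutree δ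
  decreasing σ linear = record { tree = tree ; σ = σ ; σ-linear = linear }

  -- Both trees have `w` as their `level`, so `arrow⇒path` turns each arrow of one into a path of
  -- the other; with the converse below, the tree order depends on `w` alone.
  ⊑⇒⊑𝒯 : ∀ 𝒯 → 𝓘⁻¹ δ w 𝒯 → ∀ {i j} → i ⊑ j → Order._⊑_ (tree-of 𝒯) i j
  ⊑⇒⊑𝒯 𝒯 eq = Star.concat ∘ Star.map
    (arrow⇒path canonical-walled connected (walled w 𝒯 eq) (Order.label-connected (tree-of 𝒯)))

  ⊑𝒯⇒⊑ : ∀ 𝒯 → 𝓘⁻¹ δ w 𝒯 → ∀ {i j} → Order._⊑_ (tree-of 𝒯) i j → i ⊑ j
  ⊑𝒯⇒⊑ 𝒯 eq = Star.concat ∘ Star.map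
    (arrow⇒path (walled w 𝒯 eq) (Order.label-connected (tree-of 𝒯)) canonical-walled connected)

  -- The path is carried from the canonical tree to `𝒯₂` and from there, arrow by arrow through `T`,
  -- to `𝒯₁`, along which `v` rises.
  class-extends : ∀ v → v ≡[ δ ] w → ∀ {i j} → i ⊑ j → v ⟨$⟩ʳ i ≤ v ⟨$⟩ʳ j
  class-extends v (T , (𝒯₁ , 𝓘𝒯₁≈v , 𝒯₁≅T) , (𝒯₂ , 𝓘𝒯₂≈w , 𝒯₂≅T)) i⊑j =
    Walled.rising* (walled v 𝒯₁ 𝓘𝒯₁≈v)
      (Star.map (λ {a} {b} → Equivalence.from (≅⇒arrow (tree-of 𝒯₁) T 𝒯₁≅T a b) ∘
                             Equivalence.to (≅⇒arrow (tree-of 𝒯₂) T 𝒯₂≅T a b))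
                (⊑⇒⊑𝒯 𝒯₂ 𝓘𝒯₂≈w i⊑j))

  canonical-postorder : ∃ λ τ → IsPost _⊑_ τ
  canonical-postorder = PostExists.postorder canonical-walled connected _⊑?_

  τ : Permutation′ m
  τ = proj₁ canonical-postorder
  open IsPost (proj₂ canonical-postorder)

  -- The canonical tree is labelled by the identity, so each of its linear extensions is its own
  -- in-order reading; `τ` and `w` are two of them.
  τ≡w : τ ≡[ δ ] w
  τ≡w = tree , (decreasing τ extends , (λ _ → refl) , ≅-refl {T = tree})
             , (decreasing w rising* , (λ _ → refl) , ≅-refl {T = tree})

  τ-minimum : ∀ v → v ≡[ δ ] w → τ ≤L v
  τ-minimum v v≡w = post-≤L {v = v} (proj₂ canonical-postorder) (class-extends v v≡w)

  π↓-τ : π↓ δ w τ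
  π↓-τ = τ≡w , λ v v≡w v≤τ → ≤L-antisym v τ v≤τ (τ-minimum v v≡w)

  -- `π↓` asks for a minimal element; as `τ` lies below the whole class, a minimal `π` must be `τ`.
  π↓-unique : ∀ π → π↓ δ w π → τ ≈ π
  π↓-unique π (π≡w , minimal) = minimal τ τ≡w (τ-minimum π π≡w)

  sorted : Permutation′ m
  sorted = w ↔-∘ ↔-sym τ

  𝐒-sorted : 𝐒 δ w sorted
  𝐒-sorted = τ , π↓-τ , λ _ → refl

  𝐒⇒sorted : ∀ v → 𝐒 δ w v → sorted ≈ v
  𝐒⇒sorted v (π , minimal , wπ⁻¹≈v) i = trans (cong (w ⟨$⟩ʳ_) τ⁻¹≡π⁻¹) (wπ⁻¹≈v i)
    where
    τ⁻¹≡π⁻¹ : τ ⟨$⟩ˡ i ≡ π ⟨$⟩ˡ i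
    τ⁻¹≡π⁻¹ = permutation-injective τ
      (trans (inverseʳ τ) (sym (trans (π↓-unique π minimal _) (inverseʳ π))))

  𝓟𝓘⁻¹-sorted : 𝓟∘𝓘⁻¹ δ w sorted
  𝓟𝓘⁻¹-sorted = decreasing w rising* , (λ _ → refl) , τ , (extends , leftToRight) , λ _ → refl

  -- On labels the postorder `ρ` of `𝒯` becomes `ρ p⁻¹`, which equals `τ` by uniqueness. With
  -- `w = σ p⁻¹`, the labelling `p` cancels in `w τ⁻¹ = σ ρ⁻¹`.
  𝓟𝓘⁻¹⇒sorted : ∀ v → 𝓟∘𝓘⁻¹ δ w v → sorted ≈ v
  𝓟𝓘⁻¹⇒sorted v (𝒯 , 𝓘𝒯≈w , ρ , ρ-post , σρ⁻¹≈v) i =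
    trans (cong (w ⟨$⟩ʳ_) τ⁻¹≡) (trans (sym (𝓘𝒯≈w _)) (trans (cong (to σ) (strictlyInverseʳ p _)) (σρ⁻¹≈v i)))
    where
    open DecreasingPermutree 𝒯 using (σ; p)
    τ≈ : τ ≈ (ρ ↔-∘ ↔-sym p)
    τ≈ = post-unique (⊑⇒⊑𝒯 𝒯 𝓘𝒯≈w) (⊑𝒯⇒⊑ 𝒯 𝓘𝒯≈w) (proj₂ canonical-postorder)
           (Order.post (tree-of 𝒯) {ρ} ρ-post)
    τ⁻¹≡ : τ ⟨$⟩ˡ i ≡ to p (from ρ i)
    τ⁻¹≡ = permutation-injective τ (trans (inverseʳ τ) (sym (trans (τ≈ _)
             (trans (cong (to ρ) (strictlyInverseʳ p _)) (strictlyInverseˡ ρ i)))))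

proposition6p4 : ∀ {m : ℕ} (δ : Vec Decoration m) →
    IsMap (𝐒 δ) × IsMap (𝓟∘𝓘⁻¹ δ) ×
    (∀ (w v : Permutation′ m) → 𝐒 δ w v ⇔ 𝓟∘𝓘⁻¹ δ w v)
proposition6p4 δ =
    (λ w → sorted w , 𝐒-sorted w , λ {v} → 𝐒⇒sorted w v)
  , (λ w → sorted w , 𝓟𝓘⁻¹-sorted w , λ {v} → 𝓟𝓘⁻¹⇒sorted w v)
  -- Each relation determines its value up to `≈` as `sorted w`, and both are closed under `≈` in
  -- that value.
  , λ w v → mk⇔ (λ s → 𝓟∘𝓘⁻¹-resp w (sorted w) v (𝐒⇒sorted w v s) (𝓟𝓘⁻¹-sorted w))
                (λ s → 𝐒-resp w (sorted w) v (𝓟𝓘⁻¹⇒sorted w v s) (𝐒-sorted w))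
  where
  open Canonical δ
  𝐒-resp : ∀ w v v′ → v ≈ v′ → 𝐒 δ w v → 𝐒 δ w v′
  𝐒-resp w v v′ v≈v′ (π , minimal , eq) = π , minimal , λ i → trans (eq i) (v≈v′ i)
  𝓟∘𝓘⁻¹-resp : ∀ w v v′ → v ≈ v′ → 𝓟∘𝓘⁻¹ δ w v → 𝓟∘𝓘⁻¹ δ w v′
  𝓟∘𝓘⁻¹-resp w v v′ v≈v′ (𝒯 , eq₁ , τ , post , eq₂) = 𝒯 , eq₁ , τ , post , λ i → trans (eq₂ i) (v≈v′ i)
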